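{- For every integer $n>10^8$, $$0.01\log_2 n < k_{\min}(n)\le \log_2 n+1.$$ Moreover, if $k\le 0.01\log_2 n$, then Builder has a strategy to win the Painter-Builder $k$-colouring game on $[n]$ while keeping the game graph bipartite throughout the whole game.
   Context: The Painter-Builder $k$-colouring game on $[n]=\{1,\dots,n\}$ ($n\ge 2$, $k$ positive integers) is a two-player perfect-information game between Painter and Builder, who alternate turns with Painter moving first. The game graph has vertex set $[n]$ and initially no edges, and all vertices are initially uncoloured. In each round, Painter colours one previously uncoloured vertex with one of $k$ colours, and then Builder adds to the game graph an edge between two previously non-adjacent vertices. Both players must maintain that the game graph is properly coloured (no edge joins two coloured vertices of the same colour). The game ends when either all $n$ vertices are coloured (Painter wins) or Painter has no legal move, i.e. some uncoloured vertex has neighbours of all $k$ colours (Builder wins). $k_{\min}(n)$ denotes the minimum $k$ such that Painter has a winning strategy in the $k$-colouring game on $[n]$. -}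

module Defs where

open import Data.Nat using (ℕ)
open import Data.Fin using (Fin; _≟_)
open import Data.Bool using (Bool; true; false; if_then_else_; _∨_; _∧_)
open import Data.Maybe using (Maybe; just; nothing)
open import Data.Product using (Σ; _×_; ∃)
open import Data.Sum using (_⊎_)
open import Relation.Nullary using (¬_)
open import Relation.Nullary.Decidable using (⌊_⌋)
open import Relation.Binary.PropositionalEquality using (_≡_; _≢_)

-- A position of the Painter-Builder k-colouring game on [n] (vertices = Fin n).
-- col v = nothing  : v uncoloured;  col v = just c : v has colour c ∈ Fin k.
-- adj : the (symmetric, loopless) game graph as a Boolean adjacency function.
record State (n k : ℕ) : Set where
  constructor state
  field
    col : Fin n → Maybe (Fin k)
    adj : Fin n → Fin n → Bool
open State public

module _ {n k : ℕ} where

  initial : State n k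
  initial = state (λ _ → nothing) (λ _ _ → false)

  AllColoured : State n k → Set
  AllColoured s = (v : Fin n) → Σ (Fin k) (λ c → col s v ≡ just c)

  PainterLegal : State n k → Fin n → Fin k → Set
  PainterLegal s v c =
    col s v ≡ nothing × ((u : Fin n) → adj s v u ≡ true → col s u ≢ just c)

  paint : State n k → Fin n → Fin k → State n k
  paint s v c = state (λ x → if ⌊ x ≟ v ⌋ then just c else col s x) (adj s)

  BuilderLegal : State n k → Fin n → Fin n → Set
  BuilderLegal s u w =
    u ≢ w × adj s u w ≡ false ×
    ¬ Σ (Fin k) (λ c → col s u ≡ just c × col s w ≡ just c)

  addEdge : State n k → Fin n → Fin n → State n k
  addEdge s u w = state (col s)
    (λ x y → adj s x y ∨ (⌊ x ≟ u ⌋ ∧ ⌊ y ≟ w ⌋) ∨ (⌊ x ≟ w ⌋ ∧ ⌊ y ≟ u ⌋))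

  Stuck : State n k → Set
  Stuck s = Σ (Fin n) λ v → col s v ≡ nothing ×
    ((c : Fin k) → Σ (Fin n) λ u → adj s v u ≡ true × col s u ≡ just c)

  Bipartite : State n k → Set
  Bipartite s = Σ (Fin n → Bool) λ f →
    (x y : Fin n) → adj s x y ≡ true → f x ≢ f y

  data PainterWinsFrom (s : State n k) : Set where
    pmove : (v : Fin n) (c : Fin k) → PainterLegal s v c →
      (AllColoured (paint s v c) ⊎
        ((u w : Fin n) → BuilderLegal (paint s v c) u w →
          PainterWinsFrom (addEdge (paint s v c) u w))) →
      PainterWinsFrom s

  data BuilderWinsBipartiteFrom (s : State n k) : Set where
    bstuck : Stuck s → BuilderWinsBipartiteFrom s
    brespond :
      ((v : Fin n) (c : Fin k) → PainterLegal s v c →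
        ¬ AllColoured (paint s v c) ×
        Σ (Fin n) λ u → Σ (Fin n) λ w →
          BuilderLegal (paint s v c) u w ×
          Bipartite (addEdge (paint s v c) u w) ×
          BuilderWinsBipartiteFrom (addEdge (paint s v c) u w)) →
      BuilderWinsBipartiteFrom s

PainterWins : ℕ → ℕ → Set
PainterWins n k = PainterWinsFrom (initial {n} {k})

-- Builder wins the k-colouring game on [n] keeping the graph bipartite
-- throughout (the initial empty graph is bipartite).
BuilderWinsBipartite : ℕ → ℕ → Set
BuilderWinsBipartite n k = BuilderWinsBipartiteFrom (initial {n} {k})

{-# OPTIONS --safe #-}
module Submission where

-- Painter.  Give an uncoloured vertex seeing l colours the weight 2 ^ l.  With 2 ^ (k - 1) ≤ n < 2 ^ k, Painter keeps
-- the total weight below 2 ^ k and colours an endpoint of every edge joining uncoloured vertices.  Such an edge does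
-- damage only if both endpoints see the same colours, and then two equal weights merge into one.  Among the three
-- colours available for two vertices seeing k - 3 colours, one makes the survivor's colour set differ from those of
-- the (at most two) other vertices seeing k - 2 colours, so no uncoloured vertex ever sees k - 1 colours when Builder
-- is to move.
--
-- Builder.  Builder keeps many components containing an uncoloured vertex of level c (seeing at least c colours),
-- together with a set U of colours each occurring in many components, and merges only distinct components.
-- If many of these vertices lack a colour of U, Builder joins pairs seeing the same colours: colouring one endpoint
-- raises the other.  Pairs that Painter leaves alone are joined to a vertex of a missing colour of U; such a
-- pair yields level c + 1 unless Painter spends two moves on it.  If instead most of the vertices see all of U, Builder
-- passes.  Painter must then use colours outside U on them, until t ≥ 1 new colours are each frequent up to a factor
-- 2 ^ t.  In both cases a constant factor is lost per level or colour gained, so the total loss is exponential in k.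
-- Passing is possible because a vertex seeing a colour p may be joined at any time to vertices coloured p, and
-- Builder prepares n such pairs at the beginning.

open import Defs
open import Data.Nat using (ℕ; zero; suc; _+_; _∸_; _*_; _^_; _≤_; _<_; z≤n; s≤s; _≰_; _≤?_; _/_)
open import Data.Nat.Properties hiding (suc-injective) renaming (_≟_ to _≟ℕ_)
open import Data.Nat.DivMod using (m≡m%n+[m/n]*n; m%n<n; m/n*n≤m)
open import Data.Nat.ListAction using (sum)
open import Data.Nat.Tactic.RingSolver using (solve-∀)
open import Data.Fin using (Fin; zero; suc; toℕ; _≟_; funToFin; finToFun)
open import Data.Fin.Properties using (any?; all?; toℕ<n; toℕ-injective; finToFun-funToFin)
open import Data.Bool using (Bool; true; false; not; if_then_else_; _∨_; _∧_; _xor_)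
import Data.Bool.Properties as Bool
open import Data.Maybe using (just; nothing)
open import Data.Maybe.Properties using (just-injective) renaming (≡-dec to maybe-≡-dec)
open import Data.Product using (Σ; _×_; ∃; _,_; proj₁; proj₂)
open import Data.Sum using (_⊎_; inj₁; inj₂; [_,_]′)
open import Data.Empty using (⊥; ⊥-elim)
open import Data.Unit using (⊤; tt)
open import Data.List using ([]; _∷_; map)
open import Data.List.Relation.Unary.All using (All; []; _∷_)
open import Data.List.Relation.Unary.AllPairs using ([]; _∷_)
open import Data.List.Relation.Unary.Unique.Propositional using (Unique)
open import Function using (_∘_; id; case_of_; _∋_)
open import Relation.Nullary using (¬_; Dec; yes; no; does)
open import Relation.Nullary.Decidable using (⌊_⌋; _×-dec_; _⊎-dec_; ¬?; decidable-stable; _→-dec_)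
open import Relation.Unary using (Decidable)
open import Relation.Binary.PropositionalEquality using (_≡_; _≢_; refl; sym; trans; cong; cong₂; subst)

-- A Farkas certificate: A ≤ B is a nonnegative combination of the hypotheses, z the slack.
linear : ∀ {A B X Y} z → A ≤ B → X + B + z ≡ Y + A → X ≤ Y
linear {A} {B} {X} {Y} z A≤B eq = +-cancelʳ-≤ B X Y (begin
  X + B      ≤⟨ m≤m+n (X + B) z ⟩
  X + B + z  ≡⟨ eq ⟩
  Y + A      ≤⟨ +-monoʳ-≤ Y A≤B ⟩
  Y + B      ∎)
  where open ≤-Reasoning

-- Finite sums, counting and the pigeonhole principle

∑ : ∀ {n} → (Fin n → ℕ) → ℕ
∑ {zero}  f = 0
∑ {suc n} f = f zero + ∑ (f ∘ suc)

∑-mono : ∀ {n} {f g : Fin n → ℕ} → (∀ x → f x ≤ g x) → ∑ f ≤ ∑ g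
∑-mono {zero}  h = z≤n
∑-mono {suc n} h = +-mono-≤ (h zero) (∑-mono (h ∘ suc))

∑-+ : ∀ {n} (f g : Fin n → ℕ) → ∑ (λ x → f x + g x) ≡ ∑ f + ∑ g
∑-+ {zero}  f g = refl
∑-+ {suc n} f g = trans (cong (f zero + g zero +_) (∑-+ (f ∘ suc) (g ∘ suc)))
                        (swap (f zero) (g zero) (∑ (f ∘ suc)) (∑ (g ∘ suc)))
  where
  swap : ∀ a b c d → a + b + (c + d) ≡ a + c + (b + d)
  swap = solve-∀

∑-zero : ∀ {n} (f : Fin n → ℕ) → (∀ x → f x ≡ 0) → ∑ f ≡ 0
∑-zero {zero}  f h = refl
∑-zero {suc n} f h rewrite h zero = ∑-zero (f ∘ suc) (h ∘ suc)

point : ∀ {n} → Fin n → ℕ → Fin n → ℕ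
point v a x = if ⌊ x ≟ v ⌋ then a else 0

point-≢ : ∀ {n} {v x : Fin n} a → x ≢ v → point v a x ≡ 0
point-≢ {v = v} {x} a ne with x ≟ v
... | yes e = ⊥-elim (ne e)
... | no _  = refl

∑-point : ∀ {n} (v : Fin n) a → ∑ (point v a) ≡ a
∑-point {suc n} zero a =
  trans (cong (a +_) (∑-zero {n} (λ x → point zero a (suc x)) (λ x → point-≢ {v = zero} {x = suc x} a (λ ())))) (+-identityʳ a)
∑-point {suc n} (suc v) a =
  trans (≤-antisym (∑-mono (λ x → shift x)) (∑-mono (λ x → shift′ x))) (∑-point v a)
  where
  shift : ∀ x → point (suc v) a (suc x) ≤ point v a x
  shift x with x ≟ v
  ... | yes refl = ≤-refl
  ... | no ne    = z≤n
  shift′ : ∀ x → point v a x ≤ point (suc v) a (suc x)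
  shift′ x with x ≟ v
  ... | yes refl = ≤-refl
  ... | no ne    = z≤n

-- One exceptional index `v`. The corrections stand on both sides so that the same lemma yields
-- losses (`b` = 0) and gains (`a` = 0) without subtraction.
∑-trade : ∀ {n} (f g : Fin n → ℕ) (v : Fin n) a b →
  (∀ x → x ≢ v → f x ≤ g x) → f v + b ≤ g v + a → ∑ f + b ≤ ∑ g + a
∑-trade f g v a b off at = begin
  ∑ f + b                            ≡⟨ cong (∑ f +_) (sym (∑-point v b)) ⟩
  ∑ f + ∑ (point v b)                ≡⟨ sym (∑-+ f (point v b)) ⟩
  ∑ (λ x → f x + point v b x)        ≤⟨ ∑-mono pw ⟩
  ∑ (λ x → g x + point v a x)        ≡⟨ ∑-+ g (point v a) ⟩
  ∑ g + ∑ (point v a)                ≡⟨ cong (∑ g +_) (∑-point v a) ⟩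
  ∑ g + a                            ∎
  where
  open ≤-Reasoning
  pw : ∀ x → f x + point v b x ≤ g x + point v a x
  pw x with x ≟ v
  ... | yes refl = at
  ... | no ne    = +-monoˡ-≤ 0 (off x ne)

ind : ∀ {P : Set} → Dec P → ℕ
ind P? = if does P? then 1 else 0

ind-mono : ∀ {P Q : Set} (P? : Dec P) (Q? : Dec Q) → (P → Q) → ind P? ≤ ind Q?
ind-mono (no _)  Q?      h = z≤n
ind-mono (yes p) (yes _) h = ≤-refl
ind-mono (yes p) (no ¬q) h = ⊥-elim (¬q (h p))

count : ∀ {n} {P : Fin n → Set} → Decidable P → ℕ
count P? = ∑ (λ x → ind (P? x))

module _ {n : ℕ} {P Q : Fin n → Set} (P? : Decidable P) (Q? : Decidable Q) where

  count-mono : (∀ x → P x → Q x) → count P? ≤ count Q?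
  count-mono h = ∑-mono (λ x → ind-mono (P? x) (Q? x) (h x))

  count-∪ : {R : Fin n → Set} (R? : Decidable R) →
    (∀ x → P x → Q x ⊎ R x) → count P? ≤ count Q? + count R?
  count-∪ R? h = ≤-trans (∑-mono pw) (≤-reflexive (∑-+ (ind ∘ Q?) (ind ∘ R?)))
    where
    pw : ∀ x → ind (P? x) ≤ ind (Q? x) + ind (R? x)
    pw x with P? x | Q? x | R? x
    ... | no _  | _     | _     = z≤n
    ... | yes _ | yes _ | _     = s≤s z≤n
    ... | yes _ | no _  | yes _ = s≤s z≤n
    ... | yes p | no ¬q | no ¬r = ⊥-elim ([ ¬q , ¬r ]′ (h x p))

  count-lose : (w : Fin n) → (∀ x → x ≢ w → P x → Q x) → count P? ≤ suc (count Q?)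
  count-lose w h = subst (count P? ≤_) (+-comm (count Q?) 1) (subst (_≤ count Q? + 1) (+-identityʳ _)
    (∑-trade _ _ w 1 0 (λ x ne → ind-mono (P? x) (Q? x) (h x ne)) (at (P? w) (Q? w))))
    where
    at : ∀ {A B : Set} (A? : Dec A) (B? : Dec B) → ind A? + 0 ≤ ind B? + 1
    at (yes _) (yes _) = s≤s z≤n
    at (yes _) (no _)  = ≤-refl
    at (no _)  _       = z≤n

  count-gain : (w : Fin n) → ¬ P w → Q w → (∀ x → P x → Q x) → suc (count P?) ≤ count Q?
  count-gain w ¬p q h = subst (_≤ count Q?) (+-comm (count P?) 1) (subst (count P? + 1 ≤_) (+-identityʳ _)
    (∑-trade _ _ w 0 1 (λ x _ → ind-mono (P? x) (Q? x) (h x)) (at (P? w) (Q? w))))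
    where
    at : (p? : Dec (P w)) (q? : Dec (Q w)) → ind p? + 1 ≤ ind q? + 0
    at (yes p) _       = ⊥-elim (¬p p)
    at (no _)  (yes _) = ≤-refl
    at (no _)  (no ¬q) = ⊥-elim (¬q q)

∑-const : ∀ {n} a → ∑ {n} (λ _ → a) ≡ n * a
∑-const {zero}  a = refl
∑-const {suc n} a = cong (a +_) (∑-const {n} a)

module _ {n : ℕ} {P : Fin n → Set} (P? : Decidable P) where

  count-≤ : count P? ≤ n
  count-≤ = ≤-trans (∑-mono pw) (≤-reflexive (trans (∑-const {n} 1) (*-identityʳ n)))
    where
    pw : ∀ x → ind (P? x) ≤ 1
    pw x with P? x
    ... | yes _ = ≤-refl
    ... | no _  = z≤n

  count-all : (∀ x → P x) → count P? ≡ n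
  count-all h = ≤-antisym count-≤ (≤-trans (≤-reflexive (sym (trans (∑-const {n} 1) (*-identityʳ n)))) (∑-mono pw))
    where
    pw : ∀ x → 1 ≤ ind (P? x)
    pw x with P? x
    ... | yes _ = ≤-refl
    ... | no ¬p = ⊥-elim (¬p (h x))

  count-compl : count P? + count (λ x → ¬? (P? x)) ≡ n
  count-compl = trans (sym (∑-+ {n} _ _)) (trans (≤-antisym (∑-mono le) (∑-mono ge))
    (trans (∑-const {n} 1) (*-identityʳ n)))
    where
    le : ∀ x → ind (P? x) + ind (¬? (P? x)) ≤ 1
    le x with P? x
    ... | yes _ = ≤-refl
    ... | no _  = ≤-refl
    ge : ∀ x → 1 ≤ ind (P? x) + ind (¬? (P? x))
    ge x with P? x
    ... | yes _ = ≤-refl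
    ... | no _  = ≤-refl

  count-none : (∀ x → ¬ P x) → count P? ≡ 0
  count-none h = ∑-zero _ pw
    where
    pw : ∀ x → ind (P? x) ≡ 0
    pw x with P? x
    ... | yes p = ⊥-elim (h x p)
    ... | no _  = refl

  count-∃ : 1 ≤ count P? → ∃ P
  count-∃ le with any? P?
  ... | yes e = e
  ... | no ¬e with () ← subst (1 ≤_) (count-none (λ x p → ¬e (x , p))) le

  count-∃≢ : 2 ≤ count P? → (w : Fin n) → ∃ λ x → x ≢ w × P x
  count-∃≢ le w with any? (λ x → ¬? (x ≟ w) ×-dec P? x)
  ... | yes e = e
  ... | no ¬e = ⊥-elim (<-irrefl refl (≤-trans le (≤-trans (count-lose {Q = λ _ → ⊥} P? (λ _ → no id) w
                  (λ x ne p → ¬e (x , ne , p))) (s≤s (≤-reflexive (∑-zero {n} _ (λ _ → refl)))))))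

-- Induction on the number of values: either the largest value is taken twice, or dropping the at
-- most one element that takes it leaves one value and at most one element fewer.
pigeonhole : ∀ {n} {P : Fin n → Set} (P? : Decidable P) (f : Fin n → ℕ) m →
  (∀ x → P x → f x < m) → m < count P? → ∃ λ x → ∃ λ y → x ≢ y × P x × P y × f x ≡ f y
pigeonhole P? f zero bound many with x , p ← count-∃ P? many with () ← bound x p
pigeonhole {P = P} P? f (suc m) bound many = decide (2 ≤? count top?)
  where
  top? : Decidable (λ x → P x × f x ≡ m)
  top? x = P? x ×-dec (f x ≟ℕ m)
  rest? : Decidable (λ x → P x × f x ≢ m)
  rest? x = P? x ×-dec ¬? (f x ≟ℕ m)
  split : ∀ x → P x → (P x × f x ≢ m) ⊎ (P x × f x ≡ m)
  split x p with f x ≟ℕ m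
  ... | yes e = inj₂ (p , e)
  ... | no ne = inj₁ (p , ne)
  arith : ∀ m a b c → suc m + (a + (b + c + 1)) + 0 ≡ b + (suc (suc m) + (a + c))
  arith = solve-∀
  decide : Dec (2 ≤ count top?) → ∃ λ x → ∃ λ y → x ≢ y × P x × P y × f x ≡ f y
  decide (yes two) =
    let x , px , fx       = count-∃ top? (≤-trans (s≤s z≤n) two)
        y , y≢x , py , fy = count-∃≢ top? two x
    in x , y , (λ e → y≢x (sym e)) , px , py , trans fx (sym fy)
  decide (no few) =
    let x , y , x≢y , (px , _) , (py , _) , e = pigeonhole rest? f m
          (λ x (p , ne) → ≤∧≢⇒< (≤-pred (bound x p)) ne)
          (linear 0 (+-mono-≤ many (+-mono-≤ (count-∪ P? rest? top? split) (≤-pred (≰⇒> few))))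
            (arith m (count P?) (count rest?) (count top?)))
    in x , y , x≢y , px , py , e

-- What a vertex sees, and how painting and adding an edge change it

module _ {n k : ℕ} where

  Unc : State n k → Fin n → Set
  Unc s x = col s x ≡ nothing

  unc? : (s : State n k) → Decidable (Unc s)
  unc? s x = maybe-≡-dec _≟_ (col s x) nothing

  coloured : ∀ {s : State n k} {x} → ¬ Unc s x → ∃ λ c → col s x ≡ just c
  coloured {s} {x} ¬u with col s x
  ... | just c  = c , refl
  ... | nothing = ⊥-elim (¬u refl)

  unc-not-just : ∀ {s : State n k} {x c} → Unc s x → ¬ (col s x ≡ just c)
  unc-not-just e f with () ← trans (sym e) f

  uncs : State n k → ℕ
  uncs s = count (unc? s)

  Sees : State n k → Fin n → Fin k → Set
  Sees s x i = Σ (Fin n) λ u → adj s x u ≡ true × col s u ≡ just i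

  sees? : (s : State n k) (x : Fin n) → Decidable (Sees s x)
  sees? s x i = any? (λ u → (adj s x u Bool.≟ true) ×-dec maybe-≡-dec _≟_ (col s u) (just i))

  level : State n k → Fin n → ℕ
  level s x = count (sees? s x)

  legal : ∀ {s : State n k} {v c} → Unc s v → ¬ Sees s v c → PainterLegal s v c
  legal u ¬s = u , λ x a e → ¬s (x , a , e)

  unseen : ∀ {s : State n k} {v c} → PainterLegal s v c → ¬ Sees s v c
  unseen (_ , f) (x , a , e) = f x a e

  paint-here : ∀ (s : State n k) v c → col (paint s v c) v ≡ just c
  paint-here s v c with v ≟ v
  ... | yes _ = refl
  ... | no ne = ⊥-elim (ne refl)

  paint-else : ∀ (s : State n k) {v c x} → x ≢ v → col (paint s v c) x ≡ col s x
  paint-else s {v} {c} {x} ne with x ≟ v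
  ... | yes e = ⊥-elim (ne e)
  ... | no _  = refl

  paint-unc : ∀ {s : State n k} {v c x} → Unc (paint s v c) x → x ≢ v × Unc s x
  paint-unc {s} {v} {c} {x} e with x ≟ v
  ... | no ne = ne , e

  paint-just : ∀ {s : State n k} {v c x i} → Unc s v → col s x ≡ just i → col (paint s v c) x ≡ just i
  paint-just {s} {v} {c} {x} uv e = trans (paint-else s (λ { refl → unc-not-just {s} uv e })) e

  uncs-paint : ∀ {s : State n k} {v c} → Unc s v → suc (uncs (paint s v c)) ≤ uncs s
  uncs-paint {s} {v} {c} uv = count-gain (unc? (paint s v c)) (unc? s) v
    (λ e → proj₁ (paint-unc {s} {v} {c} e) refl) uv (λ x e → proj₂ (paint-unc {s} {v} {c} e))

  Sees-paint : ∀ {s : State n k} {v c x i} → Unc s v → Sees s x i → Sees (paint s v c) x i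
  Sees-paint {s} uv (u , a , e) = u , a , paint-just {s} uv e

  Sees-painted : ∀ {s : State n k} {v c x} → adj s x v ≡ true → Sees (paint s v c) x c
  Sees-painted {s} {v} {c} a = v , a , paint-here s v c

  Sees-paint⁻ : ∀ {s : State n k} {v c x i} →
    Sees (paint s v c) x i → Sees s x i ⊎ (adj s x v ≡ true × i ≡ c)
  Sees-paint⁻ {s} {v} {c} {x} {i} (u , a , e) with u ≟ v
  ... | yes refl = inj₂ (a , sym (just-injective e))
  ... | no _     = inj₁ (u , a , e)

  add-old : ∀ (s : State n k) {u w x y} → adj s x y ≡ true → adj (addEdge s u w) x y ≡ true
  add-old s e rewrite e = refl

  add-new : ∀ (s : State n k) u w → adj (addEdge s u w) u w ≡ true
  add-new s u w with u ≟ u | w ≟ w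
  ... | no ne | _     = ⊥-elim (ne refl)
  ... | _     | no ne = ⊥-elim (ne refl)
  ... | yes _ | yes _ = Bool.∨-zeroʳ (adj s u w)

  add-new˘ : ∀ (s : State n k) u w → adj (addEdge s u w) w u ≡ true
  add-new˘ s u w with u ≟ u | w ≟ w
  ... | no ne | _     = ⊥-elim (ne refl)
  ... | _     | no ne = ⊥-elim (ne refl)
  ... | yes _ | yes _ = trans (cong (adj s w u ∨_) (Bool.∨-zeroʳ _)) (Bool.∨-zeroʳ (adj s w u))

  add⁻ : ∀ (s : State n k) {u w x y} → adj (addEdge s u w) x y ≡ true →
    adj s x y ≡ true ⊎ (x ≡ u × y ≡ w) ⊎ (x ≡ w × y ≡ u)
  add⁻ s {u} {w} {x} {y} e with adj s x y | x ≟ u | y ≟ w | x ≟ w | y ≟ u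
  ... | true  | _     | _     | _     | _     = inj₁ refl
  ... | false | yes p | yes q | _     | _     = inj₂ (inj₁ (p , q))
  ... | false | _     | _     | yes p | yes q = inj₂ (inj₂ (p , q))
  ... | false | yes _ | no _  | yes _ | no _  with () ← e
  ... | false | yes _ | no _  | no _  | _     with () ← e
  ... | false | no _  | _     | yes _ | no _  with () ← e
  ... | false | no _  | _     | no _  | _     with () ← e

  Sees-add : ∀ {s : State n k} {u w x i} → Sees s x i → Sees (addEdge s u w) x i
  Sees-add {s} (z , a , e) = z , add-old s a , e

  Sees-add⁻ : ∀ {s : State n k} {u w x i} → Sees (addEdge s u w) x i →
    Sees s x i ⊎ (x ≡ u × col s w ≡ just i) ⊎ (x ≡ w × col s u ≡ just i)
  Sees-add⁻ {s} {u} {w} (z , a , e) with add⁻ s a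
  ... | inj₁ b                    = inj₁ (z , b , e)
  ... | inj₂ (inj₁ (refl , refl)) = inj₂ (inj₁ (refl , e))
  ... | inj₂ (inj₂ (refl , refl)) = inj₂ (inj₂ (refl , e))

  level-mono : ∀ {s s′ : State n k} {x y} → (∀ i → Sees s x i → Sees s′ y i) → level s x ≤ level s′ y
  level-mono {s} {s′} {x} {y} = count-mono (sees? s x) (sees? s′ y)

  level-gain : ∀ {s s′ : State n k} {x y} i → ¬ Sees s x i → Sees s′ y i →
    (∀ i → Sees s x i → Sees s′ y i) → suc (level s x) ≤ level s′ y
  level-gain {s} {s′} {x} {y} = count-gain (sees? s x) (sees? s′ y)

-- A stuck Painter cannot recover

module _ {n k : ℕ} where

  degree : State n k → Fin n → ℕ
  degree s x = count (λ y → adj s x y Bool.≟ true)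

  -- Every round colours one more vertex and raises each degree by at most one, so this holds
  -- throughout the game. It bounds the degree of a stuck vertex.
  Sparse : State n k → Set
  Sparse s = ∀ x → degree s x + uncs s ≤ n

  sparse-round : ∀ {s : State n k} {v c} u w → Unc s v → Sparse s → Sparse (addEdge (paint s v c) u w)
  sparse-round {s} {v} {c} u w uv sp x = linear 0
    (+-mono-≤ (sp x) (+-mono-≤ (uncs-paint {s = s} {v} {c} uv) deg))
    (arith (degree s x) (degree (addEdge (paint s v c) u w) x) (uncs s) (uncs (paint s v c)) n)
    where
    one-new : Dec (x ≡ u) → ∃ λ z → ∀ y → y ≢ z → adj (addEdge (paint s v c) u w) x y ≡ true → adj s x y ≡ true
    one-new (no x≢u) = u , λ y y≢u a → case (add⁻ (paint s v c) a) of λ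
      { (inj₁ b) → b ; (inj₂ (inj₁ (e , _))) → ⊥-elim (x≢u e) ; (inj₂ (inj₂ (_ , e))) → ⊥-elim (y≢u e) }
    one-new (yes refl) = w , λ y y≢w a → case (add⁻ (paint s v c) a) of λ
      { (inj₁ b) → b ; (inj₂ (inj₁ (_ , e))) → ⊥-elim (y≢w e) ; (inj₂ (inj₂ (e , f))) → ⊥-elim (y≢w (trans f e)) }
    deg : degree (addEdge (paint s v c) u w) x ≤ suc (degree s x)
    deg = count-lose (λ y → adj (addEdge (paint s v c) u w) x y Bool.≟ true) (λ y → adj s x y Bool.≟ true)
            (proj₁ (one-new (x ≟ u))) (proj₂ (one-new (x ≟ u)))
    arith : ∀ d d′ a a′ m → d′ + a′ + (m + (a + suc d)) + 0 ≡ m + (d + a + (suc a′ + d′))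
    arith = solve-∀

  -- A stuck vertex always has a non-neighbour, so Builder never runs out of moves before Painter does.
  stuck-not-won : ∀ {s : State n k} → Sparse s → Stuck s → ¬ PainterWinsFrom s
  stuck-not-won {s} sp (x , ux , all) (pmove v c pl@(uv , ok) next) = go next
    where
    x≢v : x ≢ v
    x≢v refl = let u , a , e = all c in ok u a e
    s₁ = paint s v c
    ux₁ : Unc s₁ x
    ux₁ = trans (paint-else s x≢v) ux
    -- If `x` were adjacent to all other vertices, its degree would be `n` - 1; since `x` and `v`
    -- are both uncoloured in `s`, the sum in `Sparse` would exceed `n`.
    far : ∃ λ y → x ≢ y × adj s x y ≡ false
    far with any? (λ y → ¬? (x ≟ y) ×-dec (adj s x y Bool.≟ false))
    ... | yes p = p
    ... | no ¬p = ⊥-elim (<-irrefl refl (linear {A = n + 2 + (degree s x + uncs s)} {B = suc (degree s x) + n + uncs s} 0 lhs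
                    (arith n (degree s x) (uncs s))))
      where
      full : n ≤ suc (degree s x)
      full = subst (_≤ suc (degree s x)) (count-all (λ (_ : Fin n) → yes tt) (λ _ → tt))
        (count-lose {P = λ _ → ⊤} (λ _ → yes tt) (λ y → adj s x y Bool.≟ true) x near)
        where
        near : ∀ y → y ≢ x → ⊤ → adj s x y ≡ true
        near y y≢x _ with adj s x y in eq
        ... | true  = refl
        ... | false = ⊥-elim (¬p (y , (λ e → y≢x (sym e)) , eq))
      two : 2 ≤ uncs s
      two = ≤-trans (s≤s (count-pos x ux₁)) (uncs-paint {s = s} {v} {c} uv)
        where
        count-pos : ∀ y → Unc s₁ y → 1 ≤ uncs s₁
        count-pos y uy = ≤-trans (s≤s z≤n) (count-gain {P = λ _ → ⊥} (λ _ → no id) (unc? s₁) y id uy (λ _ ()))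
      lhs : n + 2 + (degree s x + uncs s) ≤ suc (degree s x) + n + uncs s
      lhs = ≤-trans (+-mono-≤ (+-mono-≤ full two) (sp x)) (≤-reflexive (ar (degree s x) (uncs s) n))
        where
        ar : ∀ d a m → suc d + a + m ≡ suc d + m + a
        ar = solve-∀
      arith : ∀ m d a → suc m + (suc d + m + a) + 0 ≡ m + (m + 2 + (d + a))
      arith = solve-∀
    go : ¬ (AllColoured s₁ ⊎ ((u w : Fin n) → BuilderLegal s₁ u w → PainterWinsFrom (addEdge s₁ u w)))
    go (inj₁ done) = unc-not-just {s = s₁} ux₁ (proj₂ (done x))
    go (inj₂ f) with y , x≢y , ¬a ← far =
      stuck-not-won (sparse-round {s = s} {v} {c} x y uv sp)
        (x , ux₁ , λ i → Sees-add {s = s₁} (Sees-paint {s = s} uv (all i)))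
        (f x y (x≢y , ¬a , λ (i , e , _) → unc-not-just {s = s₁} ux₁ e))

  -- The two strategies are played against each other. Builder's ends at the first stuck vertex,
  -- whereas Painter's may go on colouring other vertices; `stuck-not-won` closes that gap.
  builder-beats-painter : ∀ {s : State n k} → Sparse s → BuilderWinsBipartiteFrom s → ¬ PainterWinsFrom s
  builder-beats-painter sp (bstuck st) pw = stuck-not-won sp st pw
  builder-beats-painter {s} sp (brespond f) (pmove v c pl next) with f v c pl | next
  ... | ¬all , _ | inj₁ all = ¬all all
  ... | _ , u , w , bl , _ , bw | inj₂ g =
    builder-beats-painter (sparse-round {s = s} {v} {c} u w (proj₁ pl) sp) bw (g u w bl)

initial-sparse : ∀ {n k} → Sparse (initial {n} {k})
initial-sparse {n} {k} x =
  subst (λ d → d + uncs (initial {n} {k}) ≤ n)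
    (sym (count-none (λ y → adj (initial {n} {k}) x y Bool.≟ true) (λ _ ()))) (count-≤ (unc? (initial {n} {k})))

-- Painter's strategy

off : ∀ {n} → Fin n → (Fin n → ℕ) → Fin n → ℕ
off v f x = if ⌊ x ≟ v ⌋ then 0 else f x

off-≡ : ∀ {n} (v : Fin n) f → off v f v ≡ 0
off-≡ v f with v ≟ v
... | yes _ = refl
... | no ne = ⊥-elim (ne refl)

off-≢ : ∀ {n} {v x : Fin n} f → x ≢ v → off v f x ≡ f x
off-≢ {v = v} {x} f ne with x ≟ v
... | yes e = ⊥-elim (ne e)
... | no _  = refl

∑-off : ∀ {n} (v : Fin n) f → ∑ (off v f) + f v ≤ ∑ f
∑-off v f = subst (∑ (off v f) + f v ≤_) (+-identityʳ _) (∑-trade (off v f) f v 0 (f v)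
  (λ x ne → ≤-reflexive (off-≢ f ne))
  (≤-reflexive (trans (cong (_+ f v) (off-≡ v f)) (sym (+-identityʳ _)))))

-- Zeroing `f` at the head does not change the sum over the tail, where the head does not recur, and
-- frees the head's value in the total.
∑-list : ∀ {n} (f : Fin n → ℕ) {L} → Unique L → sum (map f L) ≤ ∑ f
∑-list f [] = z≤n
∑-list f {v ∷ L} (v∉L ∷ uL) = begin
  f v + sum (map f L)         ≤⟨ +-monoʳ-≤ (f v) (drop v∉L) ⟩
  f v + sum (map (off v f) L) ≤⟨ +-monoʳ-≤ (f v) (∑-list (off v f) uL) ⟩
  f v + ∑ (off v f)           ≡⟨ +-comm (f v) _ ⟩
  ∑ (off v f) + f v           ≤⟨ ∑-off v f ⟩
  ∑ f                         ∎
  where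
  open ≤-Reasoning
  drop : ∀ {M} → All (v ≢_) M → sum (map f M) ≤ sum (map (off v f) M)
  drop []       = z≤n
  drop (v≢x ∷ r) = +-mono-≤ (≤-reflexive (sym (off-≢ f (λ e → v≢x (sym e))))) (drop r)

module _ {n k : ℕ} where

  wt : State n k → Fin n → ℕ
  wt s x = if does (unc? s x) then 2 ^ level s x else 0

  wt-unc : ∀ {s : State n k} {x} → Unc s x → wt s x ≡ 2 ^ level s x
  wt-unc {s} {x} ux with unc? s x
  ... | yes _ = refl
  ... | no ¬u = ⊥-elim (¬u ux)

  wt-≤ : ∀ {s : State n k} {x b} → (Unc s x → 2 ^ level s x ≤ b) → wt s x ≤ b
  wt-≤ {s} {x} h with unc? s x
  ... | yes u = h u
  ... | no _  = z≤n

  2^-mono : ∀ {a b} → a ≤ b → 2 ^ a ≤ 2 ^ b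
  2^-mono = ^-monoʳ-≤ 2

  wt-mono : ∀ {s t : State n k} {x} → (Unc t x → Unc s x × level t x ≤ level s x) → wt t x ≤ wt s x
  wt-mono {s} {t} {x} h = wt-≤ {t} {x} (λ ut → ≤-trans (2^-mono (proj₂ (h ut))) (≤-reflexive (sym (wt-unc {s} (proj₁ (h ut))))))

  Same : State n k → Fin n → Fin n → Set
  Same s x y = (∀ i → Sees s x i → Sees s y i) × (∀ i → Sees s y i → Sees s x i)

  -- The invariant whenever Builder is to move. By `low`, a colour remains for a vertex even after
  -- Builder shows it one more. By `distinct`, Builder cannot join two vertices of level `k` - 2
  -- seeing the same colours, the one kind of edge after which `low` could not be restored.
  record Safe (s : State n k) : Set where
    field
      apart    : ∀ x y → Unc s x → Unc s y → adj s x y ≢ true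
      light    : ∑ (wt s) < 2 ^ k
      low      : ∀ x → Unc s x → 2 + level s x ≤ k
      distinct : ∀ x y → x ≢ y → Unc s x → Unc s y → 2 + level s x ≡ k → ¬ Same s x y
  open Safe

  -- Seen from Painter a round is Builder's edge followed by Painter's answer, hence the order
  -- `paint` after `addEdge` here and below.
  new-edge-apart : ∀ {s : State n k} {u w v i} → Safe s → v ≡ u ⊎ ¬ Unc s u ⊎ ¬ Unc s w →
    ∀ x y → Unc (paint (addEdge s u w) v i) x → Unc (paint (addEdge s u w) v i) y →
    adj (paint (addEdge s u w) v i) x y ≢ true
  new-edge-apart {s} {u} {w} {v} {i} S away x y ux uy a
    with x≢v , ux′ ← paint-unc {s = addEdge s u w} {v} {i} ux
       | y≢v , uy′ ← paint-unc {s = addEdge s u w} {v} {i} uy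
    with add⁻ s {u} {w} a
  ... | inj₁ b = apart S x y ux′ uy′ b
  ... | inj₂ (inj₁ (refl , refl)) = [ (λ e → x≢v (sym e)) , [ (λ f → f ux′) , (λ f → f uy′) ]′ ]′ away
  ... | inj₂ (inj₂ (refl , refl)) = [ (λ e → y≢v (sym e)) , [ (λ f → f uy′) , (λ f → f ux′) ]′ ]′ away

  grow : ∀ {s : State n k} {u w v i y j} → Unc s v → Sees s y j → Sees (paint (addEdge s u w) v i) y j
  grow {s} {u} {w} uv se = Sees-paint {s = addEdge s u w} uv (Sees-add {s = s} se)

  -- If no other uncoloured vertex sees anything new, no level rises; a vertex of level `k` - 2 had
  -- that level before, so `distinct` is inherited as well.
  quiet : ∀ {s : State n k} {u w v i} → Safe s → Unc s v → v ≡ u ⊎ ¬ Unc s u ⊎ ¬ Unc s w →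
    (∀ y j → y ≢ v → Unc s y → Sees (paint (addEdge s u w) v i) y j → Sees s y j) →
    Safe (paint (addEdge s u w) v i)
  quiet {s} {u} {w} {v} {i} S uv away keep = record
    { apart    = new-edge-apart S away
    ; light    = ≤-<-trans (∑-mono (λ x → wt-mono {s} {t} {x} (λ ut → proj₂ (old ut) , lev ut))) (light S)
    ; low      = λ x ux → ≤-trans (+-monoʳ-≤ 2 (lev ux)) (low S x (proj₂ (old ux)))
    ; distinct = λ x y x≢y ux uy top (f , g) → distinct S x y x≢y (proj₂ (old ux)) (proj₂ (old uy))
        (≤-antisym (low S x (proj₂ (old ux)))
          (≤-trans (≤-reflexive (sym top)) (+-monoʳ-≤ 2 (lev ux))))
        ( (λ j se → keep y j (proj₁ (old uy)) (proj₂ (old uy)) (f j (up se)))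
        , (λ j se → keep x j (proj₁ (old ux)) (proj₂ (old ux)) (g j (up se))) ) }
    where
    t = paint (addEdge s u w) v i
    old : ∀ {x} → Unc t x → x ≢ v × Unc s x
    old = paint-unc {s = addEdge s u w}
    up : ∀ {y j} → Sees s y j → Sees t y j
    up = grow {s} {u} {w} uv
    lev : ∀ {x} → Unc t x → level t x ≤ level s x
    lev {x} ux = level-mono {s = t} {s} (λ j → keep x j (proj₁ (old ux)) (proj₂ (old ux)))

  -- The colour set of `y` is that of `w` together with `i`: the set `w` will have once a neighbour
  -- of it is painted `i`.
  Matches : State n k → Fin n → Fin k → Fin n → Set
  Matches s w i y = (∀ j → Sees s y j → Sees s w j ⊎ j ≡ i) × (∀ j → Sees s w j → Sees s y j) × Sees s y i

  matches? : ∀ s w i → Decidable (Matches s w i)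
  matches? s w i y = all? (λ j → sees? s y j →-dec (sees? s w j ⊎-dec (j ≟ i)))
    ×-dec all? (λ j → sees? s w j →-dec sees? s y j) ×-dec sees? s y i

  Clash : State n k → Fin n → Fin n → Fin k → Fin n → Set
  Clash s u w i y = y ≢ u × y ≢ w × Unc s y × Matches s w i y

  clash? : ∀ s u w i → Decidable (Clash s u w i)
  clash? s u w i y = ¬? (y ≟ u) ×-dec ¬? (y ≟ w) ×-dec unc? s y ×-dec matches? s w i y

  some-unseen : ∀ {s : State n k} {x} → level s x < k → ∃ λ i → ¬ Sees s x i
  some-unseen {s} {x} lt with any? (λ i → ¬? (sees? s x i))
  ... | yes p = p
  ... | no ¬p = ⊥-elim (<-irrefl refl (subst (_< k)
    (count-all (sees? s x) (λ i → decidable-stable (sees? s x i) (λ ¬s → ¬p (i , ¬s)))) lt))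

  -- Three colours are available, and three clashing vertices together with u and w would weigh 2 ^ k.
  clash-free : ∀ {s : State n k} {u w} → Safe s → u ≢ w → Unc s u → Unc s w → Same s u w →
    3 + level s u ≡ k → ∃ λ i → ¬ Sees s u i × ∀ y → ¬ Clash s u w i y
  clash-free {s} {u} {w} S u≢w uu uw same top
    with any? (λ i → ¬? (sees? s u i) ×-dec all? (λ y → ¬? (clash? s u w i y)))
  ... | yes p = p
  ... | no ¬p = ⊥-elim (<-irrefl refl (<-≤-trans (light S) (subst (_≤ ∑ (wt s)) (cong (2 ^_) top)
        (≤-trans heavy (∑-list (wt s) uniq)))))
    where
    l = level s u
    clashing : ∀ i → ¬ Sees s u i → ∃ (Clash s u w i)
    clashing i ¬s = decidable-stable (any? (clash? s u w i))
      (λ ¬c → ¬p (i , ¬s , λ y c → ¬c (y , c)))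
    three : count (λ i → ¬? (sees? s u i)) ≡ 3
    three = +-cancelˡ-≡ l _ _ (trans (count-compl (sees? s u)) (trans (sym top) (+-comm 3 l)))
    i₁ = count-∃ (λ i → ¬? (sees? s u i)) (≤-trans (s≤s z≤n) (≤-reflexive (sym three)))
    i₂ = count-∃≢ (λ i → ¬? (sees? s u i)) (≤-trans (s≤s (s≤s z≤n)) (≤-reflexive (sym three))) (proj₁ i₁)
    rest? : Decidable (λ i → i ≢ proj₁ i₁ × ¬ Sees s u i)
    rest? i = ¬? (i ≟ proj₁ i₁) ×-dec ¬? (sees? s u i)
    i₃ = count-∃≢ rest? (≤-pred (≤-trans (≤-reflexive (sym three))
           (count-lose (λ i → ¬? (sees? s u i)) rest? (proj₁ i₁) (λ _ → _,_)))) (proj₁ i₂)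
    y₁ = clashing (proj₁ i₁) (proj₂ i₁)
    y₂ = clashing (proj₁ i₂) (proj₂ (proj₂ i₂))
    y₃ = clashing (proj₁ i₃) (proj₂ (proj₂ (proj₂ i₃)))
    apart-y : ∀ {i j y z} → ¬ Sees s u j → j ≢ i → Clash s u w i y → Clash s u w j z → y ≢ z
    apart-y ¬s j≢i (_ , _ , _ , f , _) (_ , _ , _ , _ , _ , sj) refl =
      [ (λ sw → ¬s (proj₂ same _ sw)) , j≢i ]′ (f _ sj)
    uniq : Unique (u ∷ w ∷ proj₁ y₁ ∷ proj₁ y₂ ∷ proj₁ y₃ ∷ [])
    uniq = (u≢w ∷ ne (proj₁ (proj₂ y₁)) ∷ ne (proj₁ (proj₂ y₂)) ∷ ne (proj₁ (proj₂ y₃)) ∷ [])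
         ∷ (ne (proj₁ (proj₂ (proj₂ y₁))) ∷ ne (proj₁ (proj₂ (proj₂ y₂))) ∷ ne (proj₁ (proj₂ (proj₂ y₃))) ∷ [])
         ∷ (apart-y (proj₂ (proj₂ i₂)) (proj₁ (proj₂ i₂)) (proj₂ y₁) (proj₂ y₂)
            ∷ apart-y (proj₂ (proj₂ (proj₂ i₃))) (proj₁ (proj₂ (proj₂ i₃))) (proj₂ y₁) (proj₂ y₃) ∷ [])
         ∷ (apart-y (proj₂ (proj₂ (proj₂ i₃))) (proj₁ (proj₂ i₃)) (proj₂ y₂) (proj₂ y₃) ∷ [])
         ∷ [] ∷ []
      where
      ne : ∀ {x y : Fin n} → x ≢ y → y ≢ x
      ne f e = f (sym e)
    heavy-y : ∀ {i y} → ¬ Sees s u i → Clash s u w i y → 2 * 2 ^ l ≤ wt s y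
    heavy-y {i} {y} ¬s (_ , _ , uy , _ , g , si) = ≤-trans
      (2^-mono (level-gain {s = s} {s} i ¬s si (λ j su → g j (proj₁ same j su))))
      (≤-reflexive (sym (wt-unc {s} uy)))
    heavy-w : 2 ^ l ≤ wt s w
    heavy-w = ≤-trans (2^-mono (level-mono {s = s} {s} (proj₁ same))) (≤-reflexive (sym (wt-unc {s} uw)))
    -- In units of `2 ^ l` the weights are at least 1, 1, 2, 2, 2: a clashing vertex sees all that
    -- `u` sees and one colour more.
    heavy : 2 ^ (3 + l) ≤ sum (map (wt s) (u ∷ w ∷ proj₁ y₁ ∷ proj₁ y₂ ∷ proj₁ y₃ ∷ []))
    heavy = ≤-trans (≤-reflexive (arith (2 ^ l)))
      (+-mono-≤ (≤-reflexive (sym (wt-unc {s} uu))) (+-mono-≤ heavy-w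
        (+-mono-≤ (heavy-y (proj₂ i₁) (proj₂ y₁)) (+-mono-≤ (heavy-y (proj₂ (proj₂ i₂)) (proj₂ y₂))
          (+-mono-≤ (heavy-y (proj₂ (proj₂ (proj₂ i₃))) (proj₂ y₃)) ≤-refl)))))
      where
      arith : ∀ a → 2 * (2 * (2 * a)) ≡ a + (a + (2 * a + (2 * a + (2 * a + 0))))
      arith = solve-∀

  -- By `apart`, `w` is the only uncoloured vertex that sees something new. Its weight at most
  -- doubles, and the vanished weight of `u` pays for that. Clashes matter only if `w` may arrive at
  -- level `k` - 2.
  merge : ∀ {s : State n k} {u w i} → Safe s → u ≢ w → Unc s u → Unc s w → Same s u w → ¬ Sees s u i →
    3 + level s u ≤ k → (3 + level s u ≡ k → ∀ y → ¬ Clash s u w i y) → Safe (paint (addEdge s u w) u i)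
  merge {s} {u} {w} {i} S u≢w uu uw same ¬s room free = record
    { apart    = new-edge-apart S (inj₁ refl)
    ; light    = ≤-<-trans weight (light S)
    ; low      = low′
    ; distinct = distinct′ }
    where
    t = paint (addEdge s u w) u i
    l = level s u
    old : ∀ {x} → Unc t x → x ≢ u × Unc s x
    old = paint-unc {s = addEdge s u w}
    up : ∀ {y j} → Sees s y j → Sees t y j
    up = grow {s} {u} {w} uu
    seen : ∀ {y j} → y ≢ u → Unc s y → Sees t y j → Sees s y j ⊎ (y ≡ w × j ≡ i)
    seen {y} y≢u uy st with Sees-paint⁻ {s = addEdge s u w} st
    ... | inj₁ sa with Sees-add⁻ {s = s} sa
    ... | inj₁ se = inj₁ se
    ... | inj₂ (inj₁ (e , _)) = ⊥-elim (y≢u e)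
    ... | inj₂ (inj₂ (_ , e)) = ⊥-elim (unc-not-just {s = s} uu e)
    seen {y} y≢u uy st | inj₂ (a , refl) with add⁻ s {u} {w} a
    ... | inj₁ b = ⊥-elim (apart S y u uy uu b)
    ... | inj₂ (inj₁ (e , _)) = ⊥-elim (y≢u e)
    ... | inj₂ (inj₂ (e , _)) = inj₂ (e , refl)
    keep : ∀ {y} → Unc t y → y ≢ w → ∀ j → Sees t y j → Sees s y j
    keep uy y≢w j st = [ id , (λ (e , _) → ⊥-elim (y≢w e)) ]′ (seen (proj₁ (old uy)) (proj₂ (old uy)) st)
    lev : ∀ {y} → Unc t y → y ≢ w → level t y ≤ level s y
    lev uy y≢w = level-mono {s = t} {s} (keep uy y≢w)
    levw : Unc t w → level t w ≤ suc l
    levw uw′ = ≤-trans (count-lose (sees? t w) (sees? s w) i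
        (λ j j≢i st → [ id , (λ (_ , e) → ⊥-elim (j≢i e)) ]′ (seen (proj₁ (old uw′)) uw st)))
      (s≤s (level-mono {s = s} {s} (proj₂ same)))
    low′ : ∀ x → Unc t x → 2 + level t x ≤ k
    low′ x ux = split (x ≟ w)
      where
      split : Dec (x ≡ w) → 2 + level t x ≤ k
      split (yes refl) = ≤-trans (+-monoʳ-≤ 2 (levw ux)) room
      split (no x≢w)   = ≤-trans (+-monoʳ-≤ 2 (lev ux x≢w)) (low S x (proj₂ (old ux)))
    clash : ∀ {y} → y ≢ w → Unc t y → 2 + level t w ≡ k → Unc t w → ¬ Same t w y
    -- After the round `w` sees its old colours and `i`, while `y` sees what it saw before; equality
    -- of the two sets is precisely a clash.
    clash {y} y≢w uy top uw′ (f , g) = free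
      (≤-antisym room (≤-trans (≤-reflexive (sym top)) (+-monoʳ-≤ 2 (levw uw′)))) y
      ( proj₁ (old uy) , y≢w , proj₂ (old uy)
      , (λ j sy → [ inj₁ , (λ (_ , e) → inj₂ e) ]′ (seen (proj₁ (old uw′)) uw (g j (up sy))))
      , (λ j sw → keep uy y≢w j (f j (up sw)))
      , keep uy y≢w i (f i (Sees-painted {s = addEdge s u w} (add-new˘ s u w))) )
    distinct′ : ∀ x y → x ≢ y → Unc t x → Unc t y → 2 + level t x ≡ k → ¬ Same t x y
    distinct′ x y x≢y ux uy top (f , g) = split (x ≟ w) (y ≟ w)
      where
      split : Dec (x ≡ w) → Dec (y ≡ w) → ⊥
      split (yes refl) _          = clash (λ e → x≢y (sym e)) uy top ux (f , g)
      split (no x≢w)   (yes refl) = clash x≢y ux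
        (trans (cong (2 +_) (≤-antisym (level-mono {s = t} {t} g) (level-mono {s = t} {t} f))) top) uy (g , f)
      split (no x≢w)   (no y≢w)   = distinct S x y x≢y (proj₂ (old ux)) (proj₂ (old uy))
        (≤-antisym (low S x (proj₂ (old ux))) (≤-trans (≤-reflexive (sym top)) (+-monoʳ-≤ 2 (lev ux x≢w))))
        ((λ j se → keep uy y≢w j (f j (up se))) , (λ j se → keep ux x≢w j (g j (up se))))
    weight : ∑ (wt t) ≤ ∑ (wt s)
    weight = ≤-trans (≤-trans (≤-reflexive (sym (+-identityʳ _)))
      (∑-trade (wt t) (off u (wt s)) w (wt s u) 0 away here)) (∑-off u (wt s))
      where
      away : ∀ x → x ≢ w → wt t x ≤ off u (wt s) x
      away x x≢w = split (x ≟ u)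
        where
        split : Dec (x ≡ u) → wt t x ≤ off u (wt s) x
        split (yes refl) = wt-≤ {t} {x} (λ ux → ⊥-elim (proj₁ (old ux) refl))
        split (no x≢u)   = ≤-trans (wt-mono {s} {t} (λ ux → proj₂ (old ux) , lev ux x≢w))
                                   (≤-reflexive (sym (off-≢ (wt s) x≢u)))
      here : wt t w + 0 ≤ off u (wt s) w + wt s u
      here = ≤-trans (≤-reflexive (+-identityʳ _)) (wt-≤ {t} {w} (λ uw′ → begin
        2 ^ level t w                  ≤⟨ 2^-mono (levw uw′) ⟩
        2 ^ l + (2 ^ l + 0)            ≡⟨ cong (2 ^ l +_) (+-identityʳ _) ⟩
        2 ^ l + 2 ^ l                  ≤⟨ +-monoˡ-≤ _ (2^-mono (level-mono {s = s} {s} (proj₁ same))) ⟩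
        2 ^ level s w + 2 ^ l          ≡⟨ sym (cong₂ _+_ (wt-unc {s} uw) (wt-unc {s} uu)) ⟩
        wt s w + wt s u                ≡⟨ cong (_+ wt s u) (sym (off-≢ (wt s) (λ e → u≢w (sym e)))) ⟩
        off u (wt s) w + wt s u        ∎))
        where open ≤-Reasoning

  Reply : State n k → Fin n → Fin n → Set
  Reply s u w = Σ (Fin n) λ v → Σ (Fin k) λ i →
    PainterLegal (addEdge s u w) v i × Safe (paint (addEdge s u w) v i)

  addEdge-sym : ∀ {s : State n k} {u w} x y → adj (addEdge s u w) x y ≡ adj (addEdge s w u) x y
  addEdge-sym {s} {u} {w} x y = cong (adj s x y ∨_) (Bool.∨-comm (⌊ x ≟ u ⌋ ∧ ⌊ y ≟ w ⌋) _)

  -- w already sees i, so painting u with i changes nothing for w.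
  reply-invisible : ∀ {s : State n k} {u w i} → Safe s → u ≢ w → Unc s u → Unc s w →
    Sees s w i → ¬ Sees s u i → Reply s u w
  reply-invisible {s} {u} {w} {i} S u≢w uu uw swi ¬sui =
    u , i , legal {s = addEdge s u w} uu ¬seen , quiet S uu (inj₁ refl) keep
    where
    ¬seen : ¬ Sees (addEdge s u w) u i
    ¬seen se with Sees-add⁻ {s = s} se
    ... | inj₁ b = ¬sui b
    ... | inj₂ (inj₁ (_ , e)) = unc-not-just {s = s} uw e
    ... | inj₂ (inj₂ (e , _)) = u≢w e
    keep : ∀ y j → y ≢ u → Unc s y → Sees (paint (addEdge s u w) u i) y j → Sees s y j
    keep y j y≢u uy st with Sees-paint⁻ {s = addEdge s u w} st
    ... | inj₁ sa with Sees-add⁻ {s = s} sa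
    ... | inj₁ se = se
    ... | inj₂ (inj₁ (e , _)) = ⊥-elim (y≢u e)
    ... | inj₂ (inj₂ (_ , e)) = ⊥-elim (unc-not-just {s = s} uu e)
    keep y j y≢u uy st | inj₂ (a , refl) with add⁻ s {u} {w} a
    ... | inj₁ b = ⊥-elim (apart S y u uy uu b)
    ... | inj₂ (inj₁ (e , _)) = ⊥-elim (y≢u e)
    ... | inj₂ (inj₂ (refl , _)) = swi

  -- The previous case with the endpoints exchanged. The two adjacency functions agree only
  -- pointwise, so the invariant is carried over clause by clause.
  reply-invisible˘ : ∀ {s : State n k} {u w i} → Safe s → u ≢ w → Unc s u → Unc s w →
    Sees s u i → ¬ Sees s w i → Reply s u w
  reply-invisible˘ {s} {u} {w} {i} S u≢w uu uw sui ¬swi =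
    w , i , legal {s = addEdge s u w} uw ¬seen , record
      { apart = λ x y ux uy a → apart S′ x y ux uy (trans (addEdge-sym {s} {w} {u} x y) a)
      ; light = ≤-<-trans (∑-mono (λ x → wt-mono {t} {t′} (λ ux → ux , lev x))) (light S′)
      ; low = λ x ux → ≤-trans (+-monoʳ-≤ 2 (lev x)) (low S′ x ux)
      ; distinct = λ x y x≢y ux uy top (f , g) → distinct S′ x y x≢y ux uy
          (≤-antisym (low S′ x ux) (≤-trans (≤-reflexive (sym top)) (+-monoʳ-≤ 2 (lev x))))
          ((λ j se → to y (f j (from x se))) , (λ j se → to x (g j (from y se)))) }
    where
    t  = paint (addEdge s w u) w i
    t′ = paint (addEdge s u w) w i
    to : ∀ x {j} → Sees t′ x j → Sees t x j
    to x (z , a , e) = z , trans (addEdge-sym {s} {w} {u} x z) a , e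
    from : ∀ x {j} → Sees t x j → Sees t′ x j
    from x (z , a , e) = z , trans (addEdge-sym {s} {u} {w} x z) a , e
    lev : ∀ x → level t′ x ≤ level t x
    lev x = level-mono {s = t′} {t} {x} (λ j → to x)
    ¬seen : ¬ Sees (addEdge s u w) w i
    ¬seen se with Sees-add⁻ {s = s} se
    ... | inj₁ b = ¬swi b
    ... | inj₂ (inj₁ (e , _)) = u≢w (sym e)
    ... | inj₂ (inj₂ (_ , e)) = unc-not-just {s = s} uu e
    S′ : Safe t
    S′ = let _ , _ , _ , r = reply-invisible S (λ e → u≢w (sym e)) uw uu sui ¬swi in r

  -- `distinct` excludes level `k` - 2. Below level `k` - 3 any unseen colour will do; at level `k`
  -- - 3 the colour must avoid clashes.
  reply-same : ∀ {s : State n k} {u w} → Safe s → u ≢ w → Unc s u → Unc s w → Same s u w → Reply s u w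
  reply-same {s} {u} {w} S u≢w uu uw same = answer (m≤n⇒m<n∨m≡n room)
    where
    room : 3 + level s u ≤ k
    room = ≤∧≢⇒< (low S u uu) (λ top → distinct S u w u≢w uu uw top same)
    ¬seen : ∀ {i} → ¬ Sees s u i → ¬ Sees (addEdge s u w) u i
    ¬seen ¬s se with Sees-add⁻ {s = s} se
    ... | inj₁ b = ¬s b
    ... | inj₂ (inj₁ (_ , e)) = unc-not-just {s = s} uw e
    ... | inj₂ (inj₂ (e , _)) = u≢w e
    answer : 3 + level s u < k ⊎ 3 + level s u ≡ k → Reply s u w
    answer (inj₁ lt) = let i , ¬s = some-unseen {s} {u} (≤-trans (m≤n+m _ 2) room) in
      u , i , legal {s = addEdge s u w} uu (¬seen ¬s) ,
      merge S u≢w uu uw same ¬s room (λ e → ⊥-elim (<-irrefl e lt))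
    answer (inj₂ eq) = let i , ¬s , free = clash-free S u≢w uu uw same eq in
      u , i , legal {s = addEdge s u w} uu (¬seen ¬s) , merge S u≢w uu uw same ¬s room (λ _ → free)

  -- At most one endpoint is uncoloured; v is that endpoint if there is one.
  reply-alone : ∀ {s : State n k} {u w} v → Safe s → Unc s v → (Unc s u → v ≡ u) → (Unc s w → v ≡ w) →
    u ≢ w → Reply s u w
  reply-alone {s} {u} {w} v S uv onlyu onlyw u≢w =
    v , i , legal {s = addEdge s u w} uv ¬s , quiet S uv away keep
    where
    level-add : level (addEdge s u w) v ≤ suc (level s v)
    level-add = split (v ≟ u) (v ≟ w)
      where
      via : ∀ z → (∀ j → Sees (addEdge s u w) v j → Sees s v j ⊎ col s z ≡ just j) →
        level (addEdge s u w) v ≤ suc (level s v)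
      via z h with col s z in eq
      ... | nothing = ≤-trans (level-mono {s = addEdge s u w} {s} (λ j se → [ id , (λ ()) ]′ (h j se))) (n≤1+n _)
      ... | just c  = count-lose (sees? (addEdge s u w) v) (sees? s v) c
              (λ j j≢c se → [ id , (λ e → ⊥-elim (j≢c (sym (just-injective e)))) ]′ (h j se))
      split : Dec (v ≡ u) → Dec (v ≡ w) → level (addEdge s u w) v ≤ suc (level s v)
      split (yes refl) _ = via w (λ j se → case (Sees-add⁻ {s = s} se) of λ
        { (inj₁ b) → inj₁ b ; (inj₂ (inj₁ (_ , e))) → inj₂ e ; (inj₂ (inj₂ (e , _))) → ⊥-elim (u≢w e) })
      split (no _) (yes refl) = via u (λ j se → case (Sees-add⁻ {s = s} se) of λ
        { (inj₁ b) → inj₁ b ; (inj₂ (inj₁ (e , _))) → ⊥-elim (u≢w (sym e)) ; (inj₂ (inj₂ (_ , e))) → inj₂ e })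
      -- Here `v` is no endpoint and sees nothing new; it merely fills the place of the other
      -- endpoint.
      split (no a) (no b) = via v (λ j se → case (Sees-add⁻ {s = s} se) of λ
        { (inj₁ b) → inj₁ b ; (inj₂ (inj₁ (e , _))) → ⊥-elim (a e) ; (inj₂ (inj₂ (e , _))) → ⊥-elim (b e) })
    -- Level at most `k` - 2 before the edge, hence at most `k` - 1 after it.
    found = some-unseen {addEdge s u w} {v} (≤-trans (s≤s level-add) (low S v uv))
    i = proj₁ found
    ¬s = proj₂ found
    away : v ≡ u ⊎ ¬ Unc s u ⊎ ¬ Unc s w
    away with unc? s u
    ... | yes uu = inj₁ (onlyu uu)
    ... | no ¬uu = inj₂ (inj₁ ¬uu)
    keep : ∀ y j → y ≢ v → Unc s y → Sees (paint (addEdge s u w) v i) y j → Sees s y j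
    keep y j y≢v uy st with Sees-paint⁻ {s = addEdge s u w} st
    ... | inj₁ sa with Sees-add⁻ {s = s} sa
    ... | inj₁ se = se
    ... | inj₂ (inj₁ (refl , _)) = ⊥-elim (y≢v (sym (onlyu uy)))
    ... | inj₂ (inj₂ (refl , _)) = ⊥-elim (y≢v (sym (onlyw uy)))
    keep y j y≢v uy st | inj₂ (a , refl) with add⁻ s {u} {w} a
    ... | inj₁ b = ⊥-elim (apart S y v uy uv b)
    ... | inj₂ (inj₁ (refl , _)) = ⊥-elim (y≢v (sym (onlyu uy)))
    ... | inj₂ (inj₂ (refl , _)) = ⊥-elim (y≢v (sym (onlyw uy)))

  safe-reply : ∀ {s : State n k} {u w} → Safe s → u ≢ w → ∃ (Unc s) → Reply s u w
  safe-reply {s} {u} {w} S u≢w (z , uz) with unc? s u | unc? s w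
  ... | no ¬u  | no ¬w  = reply-alone z S uz (λ uu → ⊥-elim (¬u uu)) (λ uw → ⊥-elim (¬w uw)) u≢w
  ... | yes uu | no ¬w  = reply-alone u S uu (λ _ → refl) (λ uw → ⊥-elim (¬w uw)) u≢w
  ... | no ¬u  | yes uw = reply-alone w S uw (λ uu → ⊥-elim (¬u uu)) (λ _ → refl) u≢w
  ... | yes uu | yes uw with any? (λ i → sees? s w i ×-dec ¬? (sees? s u i))
  ... | yes (i , a , b) = reply-invisible S u≢w uu uw a b
  ... | no ¬p with any? (λ i → sees? s u i ×-dec ¬? (sees? s w i))
  ... | yes (i , a , b) = reply-invisible˘ S u≢w uu uw a b
  ... | no ¬q = reply-same S u≢w uu uw
    ( (λ i a → decidable-stable (sees? s w i) (λ b → ¬q (i , a , b)))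
    , (λ i a → decidable-stable (sees? s u i) (λ b → ¬p (i , a , b))) )

  painter-from : ∀ m {s : State n k} {u w} → uncs s ≤ m → Safe s → u ≢ w → ∃ (Unc s) →
    PainterWinsFrom (addEdge s u w)
  painter-from zero {s} le S u≢w (z , uz) with () ←
    ≤-trans (count-gain {P = λ _ → ⊥} (λ _ → no id) (unc? s) z id uz (λ _ ())) le
  painter-from (suc m) {s} {u} {w} le S u≢w some
    with v , i , pl , S′ ← safe-reply {s} {u} {w} S u≢w some = pmove v i pl (next (any? (unc? t)))
    where
    t = paint (addEdge s u w) v i
    next : Dec (∃ (Unc t)) → AllColoured t ⊎ ((x y : Fin n) → BuilderLegal t x y → PainterWinsFrom (addEdge t x y))
    next (yes more) = inj₂ (λ x y bl → painter-from m
      (≤-pred (≤-trans (uncs-paint {s = addEdge s u w} {v} {i} (proj₁ pl)) le)) S′ (proj₁ bl) more)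
    next (no none)  = inj₁ (λ x → coloured {s = t} (λ ux → none (x , ux)))

-- After an arbitrary first move there are no edges yet, so all weights are at most 1 and their sum
-- is at most `n`. For `k` at least 3 level 0 is below `k` - 2, which makes `distinct` vacuous.
painter-wins : ∀ {n k} → 1 ≤ n → 3 ≤ k → n < 2 ^ k → PainterWins n k
painter-wins {suc n} {suc k} _ 3≤k n<2^k = pmove zero zero (refl , λ _ ()) (next (any? (unc? t)))
  where
  s : State (suc n) (suc k)
  s = initial
  t = paint s zero zero
  none : ∀ x → level t x ≡ 0
  none x = count-none (sees? t x) (λ { j (_ , () , _) })
  S : Safe t
  S = record
    { apart = λ _ _ _ _ ()
    ; light = ≤-<-trans (≤-trans (∑-mono (λ x → wt-≤ {s = t} {x} (λ _ → ≤-reflexive (cong (2 ^_) (none x)))))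
                (≤-reflexive (trans (∑-const {suc n} 1) (*-identityʳ _)))) n<2^k
    ; low = λ x _ → ≤-trans (≤-reflexive (cong (2 +_) (none x))) (≤-trans (n≤1+n 2) 3≤k)
    ; distinct = λ x _ _ _ _ top → ⊥-elim (<-irrefl (trans (cong (2 +_) (sym (none x))) top) 3≤k) }
  next : Dec (∃ (Unc t)) → AllColoured t ⊎ ((x y : Fin (suc n)) → BuilderLegal t x y → PainterWinsFrom (addEdge t x y))
  next (yes more) = inj₂ (λ x y bl → painter-from (uncs t) ≤-refl S (proj₁ bl) more)
  next (no ¬p)    = inj₁ (λ x → coloured {s = t} (λ ux → ¬p (x , ux)))

-- Builder's strategy

Win : ∀ {n k} → State n k → Set
Win = BuilderWinsBipartiteFrom

-- A label class is a union of components of the game graph; the sides of different classes are unrelated,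
-- so a class may be flipped as a whole when it is merged into another one.
record Position (n k : ℕ) : Set where
  field
    st     : State n k
    comp   : Fin n → Fin n
    side   : Fin n → Bool
    edge   : ∀ x y → adj st x y ≡ true → comp x ≡ comp y × side x ≢ side y
    mirror : ∀ x y → adj st x y ≡ true → adj st y x ≡ true
    proper : ∀ x y c → adj st x y ≡ true → col st x ≡ just c → col st y ≢ just c
open Position

-- Builder's moves: linking two classes, or passing inside one

module _ {n k : ℕ} where

  SameColour : State n k → Fin n → Fin n → Set
  SameColour s u w = Σ (Fin k) λ c → col s u ≡ just c × col s w ≡ just c

  paintP : (p : Position n k) (v : Fin n) (c : Fin k) → PainterLegal (st p) v c → Position n k
  paintP p v c (uv , ok) = record
    { st = paint (st p) v c ; comp = comp p ; side = side p ; edge = edge p ; mirror = mirror p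
    ; proper = prop }
    where
    prop : ∀ x y i → adj (st p) x y ≡ true → col (paint (st p) v c) x ≡ just i → col (paint (st p) v c) y ≢ just i
    prop x y i a ex ey with x ≟ v | y ≟ v
    ... | yes refl | yes refl = proj₂ (edge p x x a) refl
    ... | yes refl | no _     = ok y a (trans ey (sym ex))
    ... | no _     | yes refl = ok x (mirror p x y a) (trans ex (sym ey))
    ... | no _     | no _     = proper p x y i a ex ey

  addP : (p : Position n k) (u w : Fin n) → ¬ SameColour (st p) u w →
    (comp′ : Fin n → Fin n) (side′ : Fin n → Bool) →
    (∀ x y → adj (st p) x y ≡ true → comp′ x ≡ comp′ y × side′ x ≢ side′ y) →
    comp′ u ≡ comp′ w → side′ u ≢ side′ w → Position n k
  addP p u w nc comp′ side′ old ec es = record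
    { st = addEdge (st p) u w ; comp = comp′ ; side = side′ ; edge = edg ; mirror = mir ; proper = prop }
    where
    edg : ∀ x y → adj (addEdge (st p) u w) x y ≡ true → comp′ x ≡ comp′ y × side′ x ≢ side′ y
    edg x y a with add⁻ (st p) {u} {w} a
    ... | inj₁ b = old x y b
    ... | inj₂ (inj₁ (refl , refl)) = ec , es
    ... | inj₂ (inj₂ (refl , refl)) = sym ec , λ e → es (sym e)
    mir : ∀ x y → adj (addEdge (st p) u w) x y ≡ true → adj (addEdge (st p) u w) y x ≡ true
    mir x y a with add⁻ (st p) {u} {w} a
    ... | inj₁ b = add-old (st p) (mirror p x y b)
    ... | inj₂ (inj₁ (refl , refl)) = add-new˘ (st p) u w
    ... | inj₂ (inj₂ (refl , refl)) = add-new (st p) u w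
    prop : ∀ x y c → adj (addEdge (st p) u w) x y ≡ true → col (st p) x ≡ just c → col (st p) y ≢ just c
    prop x y c a ex ey with add⁻ (st p) {u} {w} a
    ... | inj₁ b = proper p x y c b ex ey
    ... | inj₂ (inj₁ (refl , refl)) = nc (c , ex , ey)
    ... | inj₂ (inj₂ (refl , refl)) = nc (c , ey , ex)

  relabel : Position n k → Fin n → Fin n → Fin n → Fin n
  relabel p u w x = if ⌊ comp p x ≟ comp p w ⌋ then comp p u else comp p x

  -- The class of `w` is flipped exactly when `u` and `w` are on the same side.
  reside : Position n k → Fin n → Fin n → Fin n → Bool
  reside p u w x = if ⌊ comp p x ≟ comp p w ⌋ then side p x xor not (side p u xor side p w) else side p x

  relabel-moved : ∀ p u w {x} → comp p x ≡ comp p w → relabel p u w x ≡ comp p u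
  relabel-moved p u w {x} e with comp p x ≟ comp p w
  ... | yes _ = refl
  ... | no ne = ⊥-elim (ne e)

  relabel-kept : ∀ p u w {x} → comp p x ≢ comp p w → relabel p u w x ≡ comp p x
  relabel-kept p u w {x} ne with comp p x ≟ comp p w
  ... | yes e = ⊥-elim (ne e)
  ... | no _  = refl

  reside-kept : ∀ p u w {x} → comp p x ≢ comp p w → reside p u w x ≡ side p x
  reside-kept p u w {x} ne with comp p x ≟ comp p w
  ... | yes e = ⊥-elim (ne e)
  ... | no _  = refl

  linkP : (p : Position n k) (u w : Fin n) → comp p u ≢ comp p w → ¬ SameColour (st p) u w → Position n k
  linkP p u w ne nc = addP p u w nc (relabel p u w) (reside p u w) old
    (trans (relabel-kept p u w ne) (sym (relabel-moved p u w refl))) new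
    where
    old : ∀ x y → adj (st p) x y ≡ true → relabel p u w x ≡ relabel p u w y × reside p u w x ≢ reside p u w y
    old x y a with edge p x y a
    ... | e , s with comp p x ≟ comp p w | comp p y ≟ comp p w
    ... | yes _ | yes _ = refl , λ f → s (xor-cancel (not (side p u xor side p w)) f)
      where
      xor-cancel : ∀ b {c d} → c xor b ≡ d xor b → c ≡ d
      xor-cancel b {true}  {true}  f = refl
      xor-cancel b {false} {false} f = refl
      xor-cancel true  {true}  {false} ()
      xor-cancel true  {false} {true}  ()
      xor-cancel false {true}  {false} ()
      xor-cancel false {false} {true}  ()
    ... | yes q | no r  = ⊥-elim (r (trans (sym e) q))
    ... | no r  | yes q = ⊥-elim (r (trans e q))
    ... | no _  | no _  = e , s
    new : reside p u w u ≢ reside p u w w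
    new f with comp p u ≟ comp p w | comp p w ≟ comp p w
    ... | yes e | _     = ne e
    ... | no _  | no r  = r refl
    ... | no _  | yes _ = flip (side p u) (side p w) f
      where
      flip : ∀ a b → a ≢ b xor not (a xor b)
      flip true  true  ()
      flip true  false ()
      flip false true  ()
      flip false false ()

  passP : (p : Position n k) (u w : Fin n) → comp p u ≡ comp p w → side p u ≢ side p w →
    ¬ SameColour (st p) u w → Position n k
  passP p u w ec es nc = addP p u w nc (comp p) (side p) (edge p) ec es

  -- Class `g` has the same vertices, colours and edges in both positions. Neighbours share a class,
  -- so its vertices also see the same colours in both.
  record Agree (g : Fin n) (p q : Position n k) : Set where
    field
      into : ∀ {x} → comp p x ≡ g → comp q x ≡ g
      back : ∀ {x} → comp q x ≡ g → comp p x ≡ g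
      cols : ∀ {x} → comp p x ≡ g → col (st q) x ≡ col (st p) x
      adjs : ∀ {x} → comp p x ≡ g → ∀ y → adj (st q) x y ≡ adj (st p) x y
  open Agree

  Agree-sym : ∀ {g p q} → Agree g p q → Agree g q p
  Agree-sym a = record
    { into = back a ; back = into a
    ; cols = λ e → sym (cols a (back a e)) ; adjs = λ e y → sym (adjs a (back a e) y) }

  agree-unc : ∀ {g p q x} → Agree g p q → comp p x ≡ g → Unc (st p) x → Unc (st q) x
  agree-unc a e u = trans (cols a e) u

  agree-adj : ∀ {g p q x y} → Agree g p q → comp p x ≡ g → adj (st p) x y ≡ true → adj (st q) x y ≡ true
  agree-adj a e b = trans (adjs a e _) b

  agree-sees : ∀ {g p q x i} → Agree g p q → comp p x ≡ g → Sees (st p) x i → Sees (st q) x i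
  agree-sees {p = p} a e (z , b , f) =
    z , agree-adj a e b , trans (cols a (trans (sym (proj₁ (edge p _ z b))) e)) f

  agree-level : ∀ {g p q x c} → Agree g p q → comp p x ≡ g → c ≤ level (st p) x → c ≤ level (st q) x
  agree-level {p = p} {q} a e le = ≤-trans le (level-mono {s = st p} {st q} (λ i → agree-sees a e))

  agree-paint : ∀ {p g v c pl} → g ≢ comp p v → Agree g p (paintP p v c pl)
  agree-paint {p} {g} {v} ne = record
    { into = id ; back = id ; adjs = λ _ _ → refl
    ; cols = λ e → paint-else (st p) (λ { refl → ne (sym e) }) }

  agree-addEdge : ∀ {p : Position n k} {g u w} → g ≢ comp p u → g ≢ comp p w →
    ∀ {x} → comp p x ≡ g → ∀ y → adj (addEdge (st p) u w) x y ≡ adj (st p) x y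
  agree-addEdge {p} {g} {u} {w} nu nw {x} e y with x ≟ u | x ≟ w
  ... | yes refl | _        = ⊥-elim (nu (sym e))
  ... | no _     | yes refl = ⊥-elim (nw (sym e))
  ... | no _     | no _     = Bool.∨-identityʳ _

  agree-link : ∀ {p g u w ne nc} → g ≢ comp p u → g ≢ comp p w → Agree g p (linkP p u w ne nc)
  agree-link {p} {g} {u} {w} nu nw = record
    { into = λ e → trans (relabel-kept p u w (λ f → nw (trans (sym e) f))) e
    ; back = λ {x} e → back′ x e
    ; adjs = agree-addEdge {p} nu nw
    ; cols = λ _ → refl }
    where
    back′ : ∀ x → relabel p u w x ≡ g → comp p x ≡ g
    back′ x e with comp p x ≟ comp p w
    ... | yes _ = ⊥-elim (nu (sym e))
    ... | no _  = e

  agree-pass : ∀ {p g u w ec es nc} → g ≢ comp p u → Agree g p (passP p u w ec es nc)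
  agree-pass {p} {ec = ec} nu = record
    { into = id ; back = id ; adjs = agree-addEdge {p} nu (λ e → nu (trans e (sym ec))) ; cols = λ _ → refl }

  -- A decidable property of a class that depends on nothing outside it: painting can change it for
  -- one label only, a link for two.
  record Local : Set₁ where
    field
      Holds    : Position n k → Fin n → Set
      holds?   : ∀ p → Decidable (Holds p)
      respects : ∀ {g p q} → Agree g p q → Holds p g → Holds q g
  open Local

  _∧ᴸ_ _∨ᴸ_ : Local → Local → Local
  L ∧ᴸ M = record
    { Holds = λ p g → Holds L p g × Holds M p g ; holds? = λ p g → holds? L p g ×-dec holds? M p g
    ; respects = λ a (l , m) → respects L a l , respects M a m }
  L ∨ᴸ M = record
    { Holds = λ p g → Holds L p g ⊎ Holds M p g ; holds? = λ p g → holds? L p g ⊎-dec holds? M p g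
    ; respects = λ a → [ (λ l → inj₁ (respects L a l)) , (λ m → inj₂ (respects M a m)) ]′ }

  ¬ᴸ_ : Local → Local
  ¬ᴸ L = record
    { Holds = λ p g → ¬ Holds L p g ; holds? = λ p g → ¬? (holds? L p g)
    ; respects = λ a ¬l l → ¬l (respects L (Agree-sym a) l) }

  infixr 6 _∧ᴸ_
  infixr 5 _∨ᴸ_

  record Vertexwise : Set₁ where
    field
      At    : Position n k → Fin n → Set
      at?   : ∀ p → Decidable (At p)
      local : ∀ {p q x} → Agree (comp p x) p q → At p x → At q x
  open Vertexwise

  Some : Vertexwise → Local
  Some V = record
    { Holds = λ p g → Σ (Fin n) λ x → comp p x ≡ g × At V p x
    ; holds? = λ p g → any? (λ x → (comp p x ≟ g) ×-dec at? V p x)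
    ; respects = λ { a (x , refl , h) → x , into a refl , local V a h } }

  -- The class properties that Builder counts

  common : State n k → Fin n → Fin n → ℕ
  common s u w = count (λ i → sees? s u i ×-dec sees? s w i)

  common-mono : ∀ {s t : State n k} {u w} → (∀ x i → x ≡ u ⊎ x ≡ w → Sees s x i → Sees t x i) →
    common s u w ≤ common t u w
  common-mono {s} {t} {u} {w} h = count-mono (λ i → sees? s u i ×-dec sees? s w i) (λ i → sees? t u i ×-dec sees? t w i)
    (λ i (a , b) → h u i (inj₁ refl) a , h w i (inj₂ refl) b)

  Lacks : (Fin k → Bool) → State n k → Fin n → Set
  Lacks U s x = Σ (Fin k) λ i → U i ≡ true × ¬ Sees s x i

  lacks? : ∀ U s → Decidable (Lacks U s)
  lacks? U s x = any? (λ i → (U i Bool.≟ true) ×-dec ¬? (sees? s x i))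

  agree-lacks : ∀ {U p q x} → Agree (comp p x) p q → Lacks U (st p) x → Lacks U (st q) x
  agree-lacks a (i , t , ¬s) = i , t , λ s → ¬s (agree-sees (Agree-sym a) (into a refl) s)

  LackAt FullAt : ℕ → (Fin k → Bool) → State n k → Fin n → Set
  LackAt c U s x = Unc s x × c ≤ level s x × Lacks U s x
  FullAt c U s x = Unc s x × c ≤ level s x × (∀ i → U i ≡ true → Sees s x i)

  -- An edge between uncoloured vertices sharing `c` colours. Painting one endpoint must use a
  -- colour outside the shared ones, so it lifts the other to level `c` + 1.
  Twin : ℕ → (State n k → Fin n → Set) → State n k → Fin n → Set
  Twin c E s u = Unc s u × (Σ (Fin n) λ w → adj s u w ≡ true × Unc s w × c ≤ common s u w) × E s u

  high : ℕ → Local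
  high c = Some record
    { At = λ p x → Unc (st p) x × c ≤ level (st p) x
    ; at? = λ p x → unc? (st p) x ×-dec (c ≤? level (st p) x)
    ; local = λ a (u , l) → agree-unc a refl u , agree-level a refl l }

  supply : Fin k → Local
  supply i = Some record
    { At = λ p x → col (st p) x ≡ just i
    ; at? = λ p x → maybe-≡-dec _≟_ (col (st p) x) (just i)
    ; local = λ a e → trans (cols a refl) e }

  lacking : ℕ → (Fin k → Bool) → Local
  lacking c U = Some record
    { At = λ p → LackAt c U (st p)
    ; at? = λ p x → unc? (st p) x ×-dec (c ≤? level (st p) x) ×-dec lacks? U (st p) x
    ; local = λ a (u , l , t) → agree-unc a refl u , agree-level a refl l , agree-lacks a t }

  saturated : ℕ → (Fin k → Bool) → Local
  saturated c U = Some record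
    { At = λ p → FullAt c U (st p)
    ; at? = λ p x → unc? (st p) x ×-dec (c ≤? level (st p) x)
        ×-dec all? (λ i → (U i Bool.≟ true) →-dec sees? (st p) x i)
    ; local = λ a (u , l , f) → agree-unc a refl u , agree-level a refl l , λ i t → agree-sees a refl (f i t) }

  foreign : (Fin k → Bool) → Local
  foreign U = Some record
    { At = λ p x → Σ (Fin k) λ i → U i ≡ false × col (st p) x ≡ just i
    ; at? = λ p x → any? (λ i → (U i Bool.≟ false) ×-dec maybe-≡-dec _≟_ (col (st p) x) (just i))
    ; local = λ a (i , f , e) → i , f , trans (cols a refl) e }

  agree-twin : ∀ {p q u c} → Agree (comp p u) p q →
    (Σ (Fin n) λ w → adj (st p) u w ≡ true × Unc (st p) w × c ≤ common (st p) u w) →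
    Σ (Fin n) λ w → adj (st q) u w ≡ true × Unc (st q) w × c ≤ common (st q) u w
  agree-twin {p} {q} {u} a (w , b , uw , le) =
    w , agree-adj a refl b , agree-unc a here uw ,
    ≤-trans le (common-mono {st p} {st q} λ { x i (inj₁ refl) → agree-sees a refl ; x i (inj₂ refl) → agree-sees a here })
    where
    here : comp p w ≡ comp p u
    here = sym (proj₁ (edge p u w b))

  twin? : ∀ (s : State n k) u c → Dec (Σ (Fin n) λ w → adj s u w ≡ true × Unc s w × c ≤ common s u w)
  twin? s u c = any? (λ w → (adj s u w Bool.≟ true) ×-dec unc? s w ×-dec (c ≤? common s u w))

  -- The alternative of level above `c` keeps the property alive when `u` comes to see the colour of
  -- `U` that it lacked.
  paired : ℕ → (Fin k → Bool) → Local
  paired c U = Some record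
    { At = λ p → Twin c (λ s u → Lacks U s u ⊎ c < level s u) (st p)
    ; at? = λ p u → unc? (st p) u ×-dec twin? (st p) u c ×-dec (lacks? U (st p) u ⊎-dec (suc c ≤? level (st p) u))
    ; local = λ a (u , t , e) → agree-unc a refl u , agree-twin a t ,
        [ (λ l → inj₁ (agree-lacks a l)) , (λ l → inj₂ (agree-level a refl l)) ]′ e }

  strong : ℕ → Local
  strong c = Some record
    { At = λ p → Twin c (λ s u → c < level s u) (st p)
    ; at? = λ p u → unc? (st p) u ×-dec twin? (st p) u c ×-dec (suc c ≤? level (st p) u)
    ; local = λ a (u , t , e) → agree-unc a refl u , agree-twin a t , agree-level a refl e }

-- Counting classes and the effect of a move on the counts

module Tallies {n k : ℕ} (W : Fin n) where
  open Local

  -- The class `W` houses the stored passes. As it is never counted, passing costs no tally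
  -- anything.
  tally : Local {n} {k} → Position n k → ℕ
  tally L p = count (λ g → ¬? (g ≟ W) ×-dec holds? L p g)

  tally-mono : ∀ L M {p q} → (∀ g → g ≢ W → Holds L p g → Holds M q g) → tally L p ≤ tally M q
  tally-mono L M {p} {q} h = count-mono (λ g → ¬? (g ≟ W) ×-dec holds? L p g) (λ g → ¬? (g ≟ W) ×-dec holds? M q g)
    (λ g (ne , l) → ne , h g ne l)

  tally-lose : ∀ L {p q} z → (∀ g → g ≢ z → Holds L p g → Holds L q g) → tally L p ≤ suc (tally L q)
  tally-lose L {p} {q} z h = count-lose (λ g → ¬? (g ≟ W) ×-dec holds? L p g) (λ g → ¬? (g ≟ W) ×-dec holds? L q g)
    z (λ g g≢z (ne , l) → ne , h g g≢z l)

  tally-gain : ∀ L {p q} z → z ≢ W → ¬ Holds L p z → Holds L q z → (∀ g → Holds L p g → Holds L q g) →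
    suc (tally L p) ≤ tally L q
  tally-gain L {p} {q} z z≢W ¬l l h = count-gain (λ g → ¬? (g ≟ W) ×-dec holds? L p g)
    (λ g → ¬? (g ≟ W) ×-dec holds? L q g) z (λ (_ , a) → ¬l a) (z≢W , l) (λ g (ne , a) → ne , h g a)

  tally-∪ : ∀ L M N {p} → (∀ g → Holds L p g → Holds M p g ⊎ Holds N p g) → tally L p ≤ tally M p + tally N p
  tally-∪ L M N {p} h = count-∪ (λ g → ¬? (g ≟ W) ×-dec holds? L p g) (λ g → ¬? (g ≟ W) ×-dec holds? M p g)
    (λ g → ¬? (g ≟ W) ×-dec holds? N p g)
    (λ g (ne , l) → [ (λ m → inj₁ (ne , m)) , (λ m → inj₂ (ne , m)) ]′ (h g l))

  tally-without : ∀ L M {p} → tally L p ≤ tally (L ∧ᴸ ¬ᴸ M) p + tally M p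
  tally-without L M {p} = tally-∪ L (L ∧ᴸ ¬ᴸ M) M split
    where
    split : ∀ g → Holds L p g → (Holds L p g × ¬ Holds M p g) ⊎ Holds M p g
    split g l with holds? M p g
    ... | yes m = inj₂ m
    ... | no ¬m = inj₁ (l , ¬m)

  tally-∃ : ∀ L {p} → 1 ≤ tally L p → ∃ λ g → g ≢ W × Holds L p g
  tally-∃ L {p} = count-∃ (λ g → ¬? (g ≟ W) ×-dec holds? L p g)

  tally-∃≢ : ∀ L {p} → 2 ≤ tally L p → ∀ z → ∃ λ g → g ≢ z × g ≢ W × Holds L p g
  tally-∃≢ L {p} = count-∃≢ (λ g → ¬? (g ≟ W) ×-dec holds? L p g)

  tally-paint : ∀ L {p v c pl} → tally L p ≤ suc (tally L (paintP p v c pl))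
  tally-paint L {p} {v} {c} {pl} = tally-lose L {p} {paintP p v c pl} (comp p v)
    (λ g ne → respects L (agree-paint {p = p} {c = c} {pl = pl} ne))

  tally-paint⁻ : ∀ L {p v c pl} → tally L (paintP p v c pl) ≤ suc (tally L p)
  tally-paint⁻ L {p} {v} {c} {pl} = tally-lose L {paintP p v c pl} {p} (comp p v)
    (λ g ne → respects L (Agree-sym (agree-paint {p = p} {c = c} {pl = pl} ne)))

  tally-link : ∀ L {p u w ne nc} → tally L p ≤ 2 + tally L (linkP p u w ne nc)
  tally-link L {p} {u} {w} {ne} {nc} = ≤-trans
    (count-lose (λ g → ¬? (g ≟ W) ×-dec holds? L p g) mid? (comp p u) first)
    (s≤s (count-lose mid? (λ g → ¬? (g ≟ W) ×-dec holds? L q g) (comp p w) second))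
    where
    q = linkP p u w ne nc
    mid? : Decidable (λ g → (g ≢ W × Holds L q g) ⊎ g ≡ comp p w)
    mid? g = (¬? (g ≟ W) ×-dec holds? L q g) ⊎-dec (g ≟ comp p w)
    first : ∀ g → g ≢ comp p u → g ≢ W × Holds L p g → (g ≢ W × Holds L q g) ⊎ g ≡ comp p w
    first g g≢u (g≢W , l) with g ≟ comp p w
    ... | yes e  = inj₂ e
    ... | no g≢w = inj₁ (g≢W , respects L (agree-link {p = p} {ne = ne} {nc = nc} g≢u g≢w) l)
    second : ∀ g → g ≢ comp p w → (g ≢ W × Holds L q g) ⊎ g ≡ comp p w → g ≢ W × Holds L q g
    second g g≢w = [ id , (λ e → ⊥-elim (g≢w e)) ]′

  tally-pass : ∀ L {p u w ec es nc} → comp p u ≡ W → tally L p ≤ tally L (passP p u w ec es nc)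
  tally-pass L {p} {es = es} {nc = nc} inW = tally-mono L L (λ g g≢W → respects L (agree-pass {p = p} {es = es} {nc = nc} (λ e → g≢W (trans e inW))))

  -- A label where F holds costs Painter two moves: the first only turns F into A.
  worth : Local → Local → Position n k → ℕ
  worth F A p = tally F p + tally A p

  -- If the class touched has `F`, it ends with `A`, so only the first count can drop; otherwise
  -- only the second can.
  worth-paint : ∀ F A {p v c pl} → (Holds F p (comp p v) → Holds A (paintP p v c pl) (comp p v)) →
    worth F A p ≤ suc (worth F A (paintP p v c pl))
  worth-paint F A {p} {v} {c} {pl} hit with holds? F p (comp p v)
  ... | yes f = +-mono-≤ (tally-paint F {p} {v} {c} {pl}) (tally-mono A A stay)
    where
    stay : ∀ g → g ≢ W → Holds A p g → Holds A (paintP p v c pl) g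
    stay g _ a with g ≟ comp p v
    ... | yes refl = hit f
    ... | no ne    = respects A (agree-paint {p = p} {c = c} {pl = pl} ne) a
  ... | no ¬f = ≤-trans (+-mono-≤ (tally-mono F F stay) (tally-paint A {p} {v} {c} {pl})) (≤-reflexive (+-suc _ _))
    where
    stay : ∀ g → g ≢ W → Holds F p g → Holds F (paintP p v c pl) g
    stay g _ f with g ≟ comp p v
    ... | yes refl = ⊥-elim (¬f f)
    ... | no ne    = respects F (agree-paint {p = p} {c = c} {pl = pl} ne) f

  -- Neither of the linked classes was counted before, so nothing is lost, and the merged class is
  -- new in both counts.
  worth-link : ∀ F A {p u w ne nc} → (∀ g → Holds F p g → Holds A p g) → comp p u ≢ W →
    ¬ Holds A p (comp p u) → ¬ Holds A p (comp p w) →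
    Holds F (linkP p u w ne nc) (comp p u) → Holds A (linkP p u w ne nc) (comp p u) →
    2 + worth F A p ≤ worth F A (linkP p u w ne nc)
  worth-link F A {p} {u} {w} {ne} {nc} F⊆A u≢W ¬au ¬aw fu au = ≤-trans (≤-reflexive (cong suc (sym (+-suc _ _))))
    (+-mono-≤ (tally-gain F {p} {q} (comp p u) u≢W (λ f → ¬au (F⊆A _ f)) fu (keep F F⊆A))
              (tally-gain A {p} {q} (comp p u) u≢W ¬au au (keep A (λ _ → id))))
    where
    q = linkP p u w ne nc
    keep : ∀ L → (∀ g → Holds L p g → Holds A p g) → ∀ g → Holds L p g → Holds L q g
    keep L L⊆A g l = respects L (agree-link {p = p} {g} {u} {w} {ne} {nc} (λ { refl → ¬au (L⊆A g l) }) (λ { refl → ¬aw (L⊆A g l) })) l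

  Next : State n k → Set
  Next s = ∃ (Unc s) × Σ (Fin n) λ u → Σ (Fin n) λ w →
    BuilderLegal s u w × Bipartite (addEdge s u w) × Win (addEdge s u w)

  turn : ∀ {s} → (∀ v c → PainterLegal s v c → Next (paint s v c)) → Win s
  turn {s} f = brespond λ v c pl → let (x , ux) , r = f v c pl in
    (λ all → unc-not-just {s = paint s v c} ux (proj₂ (all x))) , r

  bipartite : (p : Position n k) → Bipartite (st p)
  bipartite p = side p , λ x y a → proj₂ (edge p x y a)

  non-adjacent : ∀ {s : State n k} {u w} → ¬ (adj s u w ≡ true) → adj s u w ≡ false
  non-adjacent {s} {u} {w} h with adj s u w
  ... | true  = ⊥-elim (h refl)
  ... | false = refl

  move-link : ∀ {p u w ne nc} → ∃ (Unc (st p)) → Win (st (linkP p u w ne nc)) → Next (st p)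
  move-link {p} {u} {w} {ne} {nc} some win = some , u , w ,
    ((λ { refl → ne refl }) , non-adjacent {st p} (λ a → ne (proj₁ (edge p u w a))) , nc) ,
    bipartite (linkP p u w ne nc) , win

  -- Stored passes

  module _ (p₀ : Fin k) where

    -- Once v sees colour p₀ it never gets colour p₀, so Builder may join it to h at any time: h is a stored pass.
    Pass : Position n k → Fin n → Fin n → Set
    Pass p v h = comp p v ≡ W × comp p h ≡ W × side p v ≢ side p h × adj (st p) v h ≡ false ×
      col (st p) h ≡ just p₀ × Sees (st p) v p₀

    pass? : ∀ p v → Decidable (Pass p v)
    pass? p v h = (comp p v ≟ W) ×-dec (comp p h ≟ W) ×-dec ¬? (side p v Bool.≟ side p h) ×-dec
      (adj (st p) v h Bool.≟ false) ×-dec maybe-≡-dec _≟_ (col (st p) h) (just p₀) ×-dec sees? (st p) v p₀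

    passes : Position n k → ℕ
    passes p = ∑ (λ v → count (pass? p v))

    -- The number of uncoloured vertices bounds the number of remaining rounds, each of which uses
    -- at most one pass.
    Funded : Position n k → Set
    Funded p = uncs (st p) ≤ passes p

    passes-mono : ∀ {p q} → (∀ v h → Pass p v h → Pass q v h) → passes p ≤ passes q
    passes-mono {p} {q} f = ∑-mono (λ v → count-mono (pass? p v) (pass? q v) (f v))

    passes-paint : ∀ {p v c pl} → passes p ≤ passes (paintP p v c pl)
    passes-paint {p} {v} {c} {pl} = passes-mono {p} {paintP p v c pl} λ x h (a , b , d , e , f , g) →
      a , b , d , e , paint-just {s = st p} (proj₁ pl) f , Sees-paint {s = st p} (proj₁ pl) g

    pass-link : ∀ {p u w ne nc} → comp p w ≢ W → ∀ x h → Pass p x h → Pass (linkP p u w ne nc) x h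
    pass-link {p} {u} {w} w≢W x h (a , b , d , e , f , g) =
      trans (relabel-kept p u w x≢) a , trans (relabel-kept p u w h≢) b ,
      (λ s → d (trans (sym (reside-kept p u w x≢)) (trans s (reside-kept p u w h≢)))) ,
      non-adjacent {addEdge (st p) u w} fresh , f , Sees-add {s = st p} g
      where
      x≢ : comp p x ≢ comp p w
      x≢ s = w≢W (trans (sym s) a)
      h≢ : comp p h ≢ comp p w
      h≢ s = w≢W (trans (sym s) b)
      fresh : ¬ (adj (addEdge (st p) u w) x h ≡ true)
      fresh s with add⁻ (st p) {u} {w} s
      ... | inj₁ o with () ← trans (sym o) e
      fresh s | inj₂ (inj₁ (_ , refl)) = h≢ refl
      fresh s | inj₂ (inj₂ (refl , _)) = x≢ refl

    passes-link : ∀ {p u w ne nc} → comp p w ≢ W → passes p ≤ passes (linkP p u w ne nc)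
    passes-link {p} {u} {w} {ne} {nc} w≢W = passes-mono {p} {linkP p u w ne nc} (pass-link {p} {u} {w} {ne} {nc} w≢W)

    passes-pass : ∀ {p u w ec es nc} → Pass p u w → passes p ≤ suc (passes (passP p u w ec es nc))
    passes-pass {p} {u} {w} {ec} {es} {nc} ok = subst (passes p ≤_) (+-comm (passes q) 1)
      (subst (_≤ passes q + 1) (+-identityʳ _) (∑-trade _ _ u 1 0 elsewhere here))
      where
      q = passP p u w ec es nc
      keep : ∀ v h → v ≢ u ⊎ h ≢ w → Pass p v h → Pass q v h
      keep v h ne (a , b , d , e , f , g) =
        a , b , d , non-adjacent {addEdge (st p) u w} fresh , f , Sees-add {s = st p} g
        where
        fresh : ¬ (adj (addEdge (st p) u w) v h ≡ true)
        fresh s with add⁻ (st p) {u} {w} s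
        ... | inj₁ o with () ← trans (sym o) e
        fresh s | inj₂ (inj₁ (x , y)) = [ (λ z → z x) , (λ z → z y) ]′ ne
        -- The reversed pair was never a pass: `w` has colour `p₀` and therefore no neighbour of
        -- that colour. So only one pass is used up.
        fresh s | inj₂ (inj₂ (refl , refl)) = proper p (proj₁ g) v p₀ (mirror p v _ (proj₁ (proj₂ g)))
          (proj₂ (proj₂ g)) (proj₁ (proj₂ (proj₂ (proj₂ (proj₂ ok)))))
      elsewhere : ∀ v → v ≢ u → count (pass? p v) ≤ count (pass? q v)
      elsewhere v ne = count-mono (pass? p v) (pass? q v) (λ h → keep v h (inj₁ ne))
      here : count (pass? p u) + 0 ≤ count (pass? q u) + 1
      here = ≤-trans (≤-reflexive (+-identityʳ _)) (≤-trans
        (count-lose (pass? p u) (pass? q u) w (λ h ne → keep u h (inj₂ ne))) (≤-reflexive (+-comm 1 _)))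

    rich : ∀ {p v c pl} → Funded p → suc (uncs (st (paintP p v c pl))) ≤ passes (paintP p v c pl)
    rich {p} {v} {c} {pl} fd = ≤-trans (uncs-paint {s = st p} {v} {c} (proj₁ pl))
      (≤-trans fd (passes-paint {p} {v} {c} {pl}))

    ∑-∃ : ∀ {m} (f : Fin m → ℕ) → 1 ≤ ∑ f → ∃ λ x → 1 ≤ f x
    ∑-∃ f le with any? (λ x → 1 ≤? f x)
    ... | yes e = e
    ... | no ¬e with () ← subst (1 ≤_) (∑-zero f (λ x → n≤0⇒n≡0 (≤-pred (≰⇒> (λ l → ¬e (x , l)))))) le

    move-pass : ∀ {p} → ∃ (Unc (st p)) → suc (uncs (st p)) ≤ passes p →
      (∀ {u w ec es nc} → comp p u ≡ W → Funded (passP p u w ec es nc) → Win (st (passP p u w ec es nc))) → Next (st p)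
    move-pass {p} some fd next
      with u , hu ← ∑-∃ (λ v → count (pass? p v)) (≤-trans (s≤s z≤n) fd)
      with w , ok@(a , b , d , e , f , (z , g , h)) ← count-∃ (pass? p u) hu =
      some , u , w , ((λ { refl → d refl }) , e , nc) , bipartite q ,
      next {u} {w} {ec} {d} {nc} a (≤-pred (≤-trans fd (passes-pass {p} {u} {w} {ec} {d} {nc} ok)))
      where
      ec : comp p u ≡ comp p w
      ec = trans a (sym b)
      nc : ¬ SameColour (st p) u w
      nc (i , x , y) = proper p z u p₀ (mirror p u z g) h (trans x (trans (sym y) f))
      q = passP p u w ec d nc

-- One round costs a tally at most three classes: one for Painter's move and two for Builder's link.
lose-three : ∀ {x y z} a d → a + 3 * suc d ≤ x → x ≤ suc y → y ≤ 2 + z → a + 3 * d ≤ z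
lose-three {x} {y} {z} a d h₁ h₂ h₃ = linear 0 (+-mono-≤ h₁ (+-mono-≤ h₂ h₃)) (arith a d x y z)
  where
  arith : ∀ a d x y z → a + 3 * d + (x + (suc y + (2 + z))) + 0 ≡ z + (a + 3 * suc d + (x + y))
  arith = solve-∀

-- Painter lowers the worth by at most one and the link adds two, so the deficit to the target `t`
-- shrinks every round.
gain-one : ∀ {x y z} t d → t ≤ suc d + x → x ≤ suc y → 2 + y ≤ z → t ≤ d + z
gain-one {x} {y} {z} t d h₁ h₂ h₃ = linear 0 (+-mono-≤ h₁ (+-mono-≤ h₂ h₃)) (arith t d x y z)
  where
  arith : ∀ t d x y z → t + (suc d + x + (suc y + z)) + 0 ≡ d + z + (t + (x + (2 + y)))
  arith = solve-∀

-- `x` and `y` are the sizes of a reserve before and after Painter's move, `a` counts the classes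
-- already achieved, and `f` those still available for a link.
surplus : ∀ {x y f a} S T d → S + T + 3 * suc d ≤ x → x ≤ suc y → y ≤ f + a → a ≤ T → 2 + S ≤ f
surplus {x} {y} {f} {a} S T d h₁ h₂ h₃ h₄ = +-cancelʳ-≤ T (2 + S) f (begin
  2 + S + T                ≤⟨ linear (3 * d) (+-mono-≤ h₁ h₂) (arith S T d x y) ⟩
  y                        ≤⟨ h₃ ⟩
  f + a                    ≤⟨ +-monoʳ-≤ f h₄ ⟩
  f + T                    ∎)
  where
  open ≤-Reasoning
  arith : ∀ S T d x y → 2 + S + T + (x + suc y) + 3 * d ≡ y + (S + T + 3 * suc d + x)
  arith = solve-∀

-- Gaining a level

module Phases {n k : ℕ} (W : Fin n) (p₀ : Fin k) where
  open Tallies {n} {k} W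
  open Local

  -- The pigeonhole principle needs a representative for every label; `W` is a dummy for labels
  -- without one.
  choose : ∀ {Q : Fin n → Set} → Dec (∃ Q) → Fin n
  choose (yes (x , _)) = x
  choose (no _)        = W

  choose-ok : ∀ {Q : Fin n → Set} (d : Dec (∃ Q)) → ∃ Q → Q (choose d)
  choose-ok (yes (_ , q)) _ = q
  choose-ok (no ¬e)       e = ⊥-elim (¬e e)

  profile : State n k → Fin n → Fin (2 ^ k)
  profile s x = funToFin {k} {2} (λ i → if does (sees? s x i) then suc zero else zero)

  profile-same : ∀ {s : State n k} {x y} → toℕ (profile s x) ≡ toℕ (profile s y) → ∀ i → Sees s x i → Sees s y i
  profile-same {s} {x} {y} e i sx = read (sees? s x i) (sees? s y i) sx
    (trans (sym (finToFun-funToFin {k} {2} _ i)) (trans (cong (λ f → finToFun {2} {k} f i) (toℕ-injective e))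
      (finToFun-funToFin {k} {2} _ i)))
    where
    read : ∀ {A B : Set} (a : Dec A) (b : Dec B) → A →
      (if does a then suc zero else zero) ≡ (Fin 2 ∋ (if does b then suc zero else zero)) → B
    read _       (yes b) _ _  = b
    read (no ¬a) (no _)  a _  = ⊥-elim (¬a a)
    read (yes _) (no _)  _ ()

  -- The colour `c` is unseen by `v`, hence outside `C`, and its neighbour `y` now sees it besides
  -- all of `C`.
  raise : ∀ {s : State n k} {v c y} {C : Fin k → Set} (C? : Decidable C) → PainterLegal s v c → adj s y v ≡ true →
    (∀ i → C i → Sees s v i × Sees s y i) → suc (count C?) ≤ level (paint s v c) y
  raise {s} {v} {c} {y} C? pl a h = count-gain C? (sees? (paint s v c) y) c
    (λ x → unseen {s = s} {v} pl (proj₁ (h c x))) (Sees-painted {s = s} a)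
    (λ i x → Sees-paint {s = s} (proj₁ pl) (proj₂ (h i x)))

  module _ {p : Position n k} {v : Fin n} {c : Fin k} {pl : PainterLegal (st p) v c} where
    private
      s = st p
      t = paint s v c
      q = paintP p v c pl
      both? : ∀ u w → Decidable (λ i → Sees s u i × Sees s w i)
      both? u w i = sees? s u i ×-dec sees? s w i
      still : ∀ {x} → v ≢ x → Unc s x → Unc t x
      still ne ux = trans (paint-else s (λ e → ne (sym e))) ux

    -- Painting an endpoint of the pair lifts the other; painting a third vertex of the class leaves
    -- the pair, and a colour of `U` that thereby stops being lacked raises the level.
    paired-hit : ∀ {d U} → Holds (paired d U) p (comp p v) → Holds (paired d U ∨ᴸ high (suc d)) q (comp p v)
    paired-hit {d} {U} (u , e , uu , (w , a , uw , le) , E) = split (v ≟ u) (v ≟ w)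
      where
      ew : comp p w ≡ comp p v
      ew = trans (sym (proj₁ (edge p u w a))) e
      split : Dec (v ≡ u) → Dec (v ≡ w) → Holds (paired d U ∨ᴸ high (suc d)) q (comp p v)
      split (yes refl) _ = inj₂ (w , ew , still (λ { refl → proj₂ (edge p u u a) refl }) uw ,
        ≤-trans (s≤s le) (raise {s} (both? u w) pl (mirror p u w a) (λ _ → id)))
      split (no v≢u) (yes refl) = inj₂ (u , e , still v≢u uu ,
        ≤-trans (s≤s le) (raise {s} (both? u w) pl a (λ _ (x , y) → y , x)))
      split (no v≢u) (no v≢w) = inj₁ (u , e , still v≢u uu ,
        (w , a , still v≢w uw , ≤-trans le (common-mono {s = s} {t} (λ _ _ _ → Sees-paint {s = s} (proj₁ pl)))) ,
        [ lack , (λ l → inj₂ (≤-trans l up)) ]′ E)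
        where
        up : level s u ≤ level t u
        up = level-mono {s = s} {t} (λ _ → Sees-paint {s = s} (proj₁ pl))
        lack : Lacks U s u → Lacks U t u ⊎ d < level t u
        lack (i , ti , ¬s) with sees? t u i
        ... | no ¬s′ = inj₁ (i , ti , ¬s′)
        ... | yes s′ = inj₂ (≤-trans (s≤s (≤-trans le (count-mono (both? u w) (sees? s u) (λ _ → proj₁))))
                (level-gain {s = s} {t} i ¬s s′ (λ _ → Sees-paint {s = s} (proj₁ pl))))

    strong-hit : ∀ {d} → Holds (strong d) p (comp p v) → Holds (high (suc d)) q (comp p v)
    strong-hit {d} (u , e , uu , (w , a , uw , le) , l) = split (v ≟ u)
      where
      split : Dec (v ≡ u) → Holds (high (suc d)) q (comp p v)
      split (yes refl) = w , trans (sym (proj₁ (edge p u w a))) e , still (λ { refl → proj₂ (edge p u u a) refl }) uw ,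
        ≤-trans (s≤s le) (raise {s} (both? u w) pl (mirror p u w a) (λ _ → id))
      split (no v≢u) = u , e , still v≢u uu , ≤-trans l (level-mono {s = s} {t} (λ _ → Sees-paint {s = s} (proj₁ pl)))

  Supplied : (Fin k → Bool) → ℕ → Position n k → Set
  Supplied U B p = ∀ i → U i ≡ true → B ≤ tally (supply i) p

  module _ (c : ℕ) (U : Fin k → Bool) where

    promising : Local {n} {k}
    promising = paired c U ∨ᴸ high (suc c)

    -- A move to which `worth-link` applies. The merged class carries the label of `from`; since
    -- `to` lies outside `W`, no stored pass is disturbed.
    record Link (F A : Local {n} {k}) (p : Position n k) : Set where
      field
        from to : Fin n
        some    : Unc (st p) from
        apart   : comp p from ≢ comp p to
        clean   : ¬ SameColour (st p) from to
        from≢W  : comp p from ≢ W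
        to≢W    : comp p to ≢ W
        ¬from   : ¬ Holds A p (comp p from)
        ¬to     : ¬ Holds A p (comp p to)
        madeF   : Holds F (linkP p from to apart clean) (comp p from)
        madeA   : Holds A (linkP p from to apart clean) (comp p from)

    twin-link : ∀ {p g h u w} → g ≢ h → g ≢ W → h ≢ W → ¬ Holds promising p g → ¬ Holds promising p h →
      comp p u ≡ g → LackAt c U (st p) u → comp p w ≡ h → LackAt c U (st p) w →
      (∀ i → Sees (st p) u i → Sees (st p) w i) → Link (paired c U) promising p
    twin-link {p} {u = u} {w} g≢h g≢W h≢W ¬g ¬h refl (uu , lu , j , tj , ¬s) refl (uw , lw , _) same = record
      { from = u ; to = w ; some = uu ; apart = g≢h ; clean = nc ; from≢W = g≢W ; to≢W = h≢W
      ; ¬from = ¬g ; ¬to = ¬h ; madeF = made ; madeA = inj₁ made }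
      where
      nc : ¬ SameColour (st p) u w
      nc (_ , e , _) = unc-not-just {s = st p} uu e
      t = addEdge (st p) u w
      lack : ¬ Sees t u j
      lack sj with Sees-add⁻ {s = st p} sj
      ... | inj₁ b = ¬s b
      ... | inj₂ (inj₁ (_ , e)) = unc-not-just {s = st p} uw e
      ... | inj₂ (inj₂ (_ , e)) = unc-not-just {s = st p} uu e
      made : Holds (paired c U) (linkP p u w g≢h nc) (comp p u)
      made = u , relabel-kept p u w g≢h , uu ,
        (w , add-new (st p) u w , uw , ≤-trans lu (count-mono (sees? (st p) u) (λ i → sees? t u i ×-dec sees? t w i)
          (λ i si → Sees-add {s = st p} si , Sees-add {s = st p} (same i si)))) ,
        inj₁ (j , tj , lack)

    -- There are only `2 ^ k` colour sets, so two of these classes have representatives seeing the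
    -- same colours.
    find-twins : ∀ {p} → 2 ^ k < tally (lacking c U ∧ᴸ ¬ᴸ promising) p → Link (paired c U) promising p
    find-twins {p} many = conclude (pigeonhole (λ g → ¬? (g ≟ W) ×-dec holds? free p g)
        (λ g → toℕ (profile (st p) (vertex g))) (2 ^ k) (λ g _ → toℕ<n (profile (st p) (vertex g))) many)
      where
      free : Local {n} {k}
      free = lacking c U ∧ᴸ ¬ᴸ promising
      vertex : Fin n → Fin n
      vertex g = choose (holds? (lacking c U) p g)
      conclude : (∃ λ g → ∃ λ h → g ≢ h × (g ≢ W × Holds free p g) × (h ≢ W × Holds free p h) ×
        toℕ (profile (st p) (vertex g)) ≡ toℕ (profile (st p) (vertex h))) → Link (paired c U) promising p
      conclude (g , h , g≢h , (g≢W , lg , ¬g) , (h≢W , lh , ¬h) , e) =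
        let cu , u = choose-ok (holds? (lacking c U) p g) lg
            cw , w = choose-ok (holds? (lacking c U) p h) lh
        in twin-link g≢h g≢W h≢W ¬g ¬h cu u cw w (profile-same {st p} {vertex g} {vertex h} e)

    raise-link : ∀ {p g h u z j} → h ≢ g → g ≢ W → h ≢ W → ¬ Holds (high (suc c)) p g → ¬ Holds (high (suc c)) p h →
      comp p u ≡ g → Unc (st p) u → (Σ (Fin n) λ w → adj (st p) u w ≡ true × Unc (st p) w × c ≤ common (st p) u w) →
      ¬ Sees (st p) u j → comp p z ≡ h → col (st p) z ≡ just j → Link (strong c) (high (suc c)) p
    raise-link {p} {u = u} {z} {j} h≢g g≢W h≢W ¬g ¬h refl uu (w , a , uw , le) ¬s refl colz = record
      { from = u ; to = z ; some = uu ; apart = ne ; clean = nc ; from≢W = g≢W ; to≢W = h≢W ; ¬from = ¬g ; ¬to = ¬h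
      ; madeF = u , relabel-kept p u z ne , uu , (w , add-old (st p) a , uw ,
                  ≤-trans le (common-mono {s = st p} {t} (λ _ _ _ → Sees-add {s = st p}))) , higher
      ; madeA = u , relabel-kept p u z ne , uu , higher }
      where
      ne : comp p u ≢ comp p z
      ne e = h≢g (sym e)
      nc : ¬ SameColour (st p) u z
      nc (_ , e , _) = unc-not-just {s = st p} uu e
      t = addEdge (st p) u z
      higher : c < level t u
      higher = ≤-trans (s≤s (≤-trans le
          (count-mono (λ i → sees? (st p) u i ×-dec sees? (st p) w i) (sees? (st p) u) (λ _ → proj₁))))
        (level-gain {s = st p} {t} j ¬s (z , add-new (st p) u z , colz) (λ _ → Sees-add {s = st p}))

    -- A paired class that is not yet high must still lack a colour of `U`. Two suppliers of it are
    -- required so that one lies in a different class.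
    find-raise : ∀ {p} → 1 ≤ tally (paired c U ∧ᴸ ¬ᴸ high (suc c)) p →
      (∀ i → U i ≡ true → 2 ≤ tally (supply i ∧ᴸ ¬ᴸ high (suc c)) p) → Link (strong c) (high (suc c)) p
    find-raise {p} one two
      with g , g≢W , (u , cu , uu , twin , E) , ¬g ← tally-∃ (paired c U ∧ᴸ ¬ᴸ high (suc c)) {p} one
      with E
    ... | inj₂ l = ⊥-elim (¬g (u , cu , uu , l))
    ... | inj₁ (j , tj , ¬s)
      with h , h≢g , h≢W , (z , cz , colz) , ¬h ← tally-∃≢ (supply j ∧ᴸ ¬ᴸ high (suc c)) {p} (two j tj) g =
      raise-link h≢g g≢W h≢W ¬g ¬h cu uu twin ¬s cz colz

    module Round (F A : Local {n} {k}) (F⊆A : ∀ {p} g → Holds F p g → Holds A p g) (src : Local {n} {k})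
      (hit : ∀ {p v i pl} → Holds F p (comp p v) → Holds A (paintP p v i pl) (comp p v)) where

      -- One round with `d` more to come: the reserves lose at most three, and the worth comes at
      -- least one closer to `T`.
      advance : ∀ {p v i pl} T B R d → Funded p₀ p → R + 3 * suc d ≤ tally src p → Supplied U (B + 3 * suc d) p →
        T ≤ suc d + worth F A p → Link F A (paintP p v i pl) →
        (∀ {q} → Funded p₀ q → R + 3 * d ≤ tally src q → Supplied U (B + 3 * d) q → T ≤ d + worth F A q → Win (st q)) →
        Next (paint (st p) v i)
      advance {p} {v} {i} {pl} T B R d fd hsrc sup wor l next = move-link {q} {from} {to} {apart} {clean} (from , some)
        (next {linkP q from to apart clean}
          (≤-trans (≤-trans (n≤1+n _) (rich p₀ {p} {v} {i} {pl} fd)) (passes-link p₀ {q} {from} {to} {apart} {clean} to≢W))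
          (lose-three R d hsrc (tally-paint src {p} {v} {i} {pl}) (tally-link src {q} {from} {to} {apart} {clean}))
          (λ j t → lose-three B d (sup j t) (tally-paint (supply j) {p} {v} {i} {pl})
            (tally-link (supply j) {q} {from} {to} {apart} {clean}))
          (gain-one T d wor (worth-paint F A {p} {v} {i} {pl} (hit {p} {v} {i} {pl}))
            (worth-link F A {q} {from} {to} {apart} {clean} F⊆A from≢W ¬from ¬to madeF madeA)))
        where
        open Link l
        q = paintP p v i pl

    open Round

    -- Joining two vertices that see the same colours: whichever Painter colours, the other one gains a level.
    pairing : ∀ S T B → 2 ^ k < S → (∀ q → Funded p₀ q → Supplied U B q → T ≤ worth (paired c U) promising q → Win (st q)) →
      ∀ d p → Funded p₀ p → S + T + 3 * d ≤ tally (lacking c U) p → Supplied U (B + 3 * d) p →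
      T ≤ d + worth (paired c U) promising p → Win (st p)
    pairing S T B big after zero p fd src sup wor = after p fd (λ i t → ≤-trans (m≤m+n B 0) (sup i t)) wor
    pairing S T B big after (suc d) p fd src sup wor = decide (T ≤? worth (paired c U) promising p)
      where
      decide : Dec (T ≤ worth (paired c U) promising p) → Win (st p)
      decide (yes done) = after p fd (λ i t → ≤-trans (m≤m+n B _) (sup i t)) done
      decide (no ¬done) = turn (λ v i pl → advance (paired c U) promising (λ _ → inj₁) (lacking c U)
        (λ {p} {v} {i} {pl} → paired-hit {p} {v} {i} {pl}) {p} {v} {i} {pl} T B (S + T) d fd src sup wor
        -- While the worth is below `T`, at most `T` classes are promising after Painter's move; the
        -- remaining more than `S` lacking ones exceed `2 ^ k`.
        (find-twins {paintP p v i pl} (≤-trans big (≤-trans (m≤n+m S 2) (surplus S T d src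
          (tally-paint (lacking c U) {p} {v} {i} {pl}) (tally-without (lacking c U) promising {paintP p v i pl})
          (≤-trans (tally-paint⁻ promising {p} {v} {i} {pl}) (≤-trans (s≤s (m≤n+m _ _)) (≰⇒> ¬done)))))))
        (λ {q} → pairing S T B big after d q))

    -- Joining u to a vertex of a colour it lacks raises u; should Painter colour u, its twin rises instead.
    strengthening : ∀ m B → m ≤ B → (∀ q → Funded p₀ q → Supplied U B q → m ≤ tally (high (suc c)) q → Win (st q)) →
      ∀ d p → Funded p₀ p → m + 3 * d ≤ tally (paired c U) p → Supplied U (B + 3 * d) p →
      2 * m ≤ d + worth (strong c) (high (suc c)) p → Win (st p)
    strengthening m B m≤B after zero p fd src sup wor =
      -- Strong classes are high, so the worth is at most twice the number of high classes.
      after p fd (λ i t → ≤-trans (m≤m+n B 0) (sup i t)) (*-cancelˡ-≤ 2 (≤-trans wor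
        (+-mono-≤ (tally-mono (strong c) (high (suc c)) {p} {p} (λ { _ _ (u , e , uu , _ , l) → u , e , uu , l }))
          (≤-reflexive (sym (+-identityʳ _))))))
    strengthening m B m≤B after (suc d) p fd src sup wor = decide (m ≤? tally (high (suc c)) p)
      where
      decide : Dec (m ≤ tally (high (suc c)) p) → Win (st p)
      decide (yes done) = after p fd (λ i t → ≤-trans (m≤m+n B _) (sup i t)) done
      decide (no ¬done) = turn reply
        where
        reply : ∀ v i → PainterLegal (st p) v i → Next (paint (st p) v i)
        reply v i pl = advance (strong c) (high (suc c)) (λ { _ (x , e , ux , _ , l) → x , e , ux , l }) (paired c U)
          (λ {p} {v} {i} {pl} → strong-hit {p} {v} {i} {pl}) {p} {v} {i} {pl} (2 * m) B m d fd src sup wor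
          (find-raise {q}
            (≤-trans (s≤s z≤n) (surplus 0 m d src (tally-paint (paired c U) {p} {v} {i} {pl})
              (tally-without (paired c U) (high (suc c)) {q}) few))
            (λ j tj → surplus 0 B d (sup j tj) (tally-paint (supply j) {p} {v} {i} {pl})
              (tally-without (supply j) (high (suc c)) {q}) (≤-trans few m≤B)))
          (λ {q} → strengthening m B m≤B after d q)
          where
          q = paintP p v i pl
          -- With at most `m` high classes, both the paired ones and the suppliers of each colour of
          -- `U` include classes that are not high.
          few : tally (high (suc c)) q ≤ m
          few = ≤-trans (tally-paint⁻ (high (suc c)) {p} {v} {i} {pl}) (≰⇒> ¬done)

-- Extracting frequent new colours

argmax : ∀ {k} (f : Fin k → ℕ) {Q : Fin k → Set} → Decidable Q → ∃ Q → ∃ λ i → Q i × ∀ j → Q j → f j ≤ f i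
argmax {suc k} f {Q} Q? e with any? (Q? ∘ suc)
... | no ¬r = zero , here e , λ { zero _ → ≤-refl ; (suc j) q → ⊥-elim (¬r (j , q)) }
  where
  here : ∃ Q → Q zero
  here (zero , q)  = q
  here (suc j , q) = ⊥-elim (¬r (j , q))
... | yes r with i , q , top ← argmax (f ∘ suc) (Q? ∘ suc) r with Q? zero
... | no ¬z = suc i , q , λ { zero z → ⊥-elim (¬z z) ; (suc j) → top j }
... | yes z with f (suc i) ≤? f zero
... | yes le = zero , z , λ { zero _ → ≤-refl ; (suc j) p → ≤-trans (top j p) le }
... | no ¬le = suc i , q , λ { zero _ → ≰⇒≥ ¬le ; (suc j) → top j }

size : ∀ {k} → (Fin k → Bool) → ℕ
size U = count (λ i → U i Bool.≟ true)

insert : ∀ {k} → Fin k → (Fin k → Bool) → Fin k → Bool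
insert i U j = ⌊ j ≟ i ⌋ ∨ U j

insert-here : ∀ {k} (i : Fin k) U → insert i U i ≡ true
insert-here i U with i ≟ i
... | yes _ = refl
... | no ne = ⊥-elim (ne refl)

insert-false : ∀ {k} (i : Fin k) U j → insert i U j ≡ false → j ≢ i × U j ≡ false
insert-false i U j e with j ≟ i
... | no ne = ne , e

insert-true : ∀ {k} (i : Fin k) U j → insert i U j ≡ true → j ≡ i ⊎ U j ≡ true
insert-true i U j e with j ≟ i
... | yes p = inj₁ p
... | no _  = inj₂ e

insert-other : ∀ {k} (i : Fin k) U j → j ≢ i → insert i U j ≡ U j
insert-other i U j ne with j ≟ i
... | yes p = ⊥-elim (ne p)
... | no _  = refl

false≢true : ∀ {b} → b ≡ false → b ≢ true
false≢true refl ()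

module _ {k m : ℕ} {P : Fin k → Fin m → Set} (P? : ∀ i → Decidable (P i)) where

  outside? : (U : Fin k → Bool) → Decidable (λ g → Σ (Fin k) λ i → U i ≡ false × P i g)
  outside? U g = any? (λ i → (U i Bool.≟ false) ×-dec P? i g)

  -- The same `t` measures the number of colours gained and the factor `2 ^ t` lost in frequency.
  -- The last clause exhibits one new colour explicitly; the induction and the opening both use it.
  Popular : (Fin k → Bool) → ℕ → Set
  Popular U X = ∃ λ V → ∃ λ t → 1 ≤ t × size U + t ≤ size V ×
    (∀ i → V i ≡ true → U i ≡ true ⊎ X ≤ 2 ^ t * count (P? i)) ×
    ∃ λ i → U i ≡ false × X ≤ 2 ^ t * count (P? i)

  -- If the most frequent new colour covers less than half of X, the others still cover X / 2.
  popular : ∀ r U X → count (λ i → U i Bool.≟ false) ≤ r → 1 ≤ X → X ≤ count (outside? U) → Popular U X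
  popular r U X le 1≤X cover = start (argmax (λ i → count (P? i)) (λ i → U i Bool.≟ false)
      (let _ , i , e , _ = count-∃ (outside? U) (≤-trans 1≤X cover) in i , e))
    where
    start : (∃ λ i → U i ≡ false × ∀ j → U j ≡ false → count (P? j) ≤ count (P? i)) → Popular U X
    start (i , e , top) = split r le (X ≤? 2 * a)
      where
      a = count (P? i)
      V₁ = insert i U
      bigger : suc (size U) ≤ size V₁
      bigger = count-gain (λ j → U j Bool.≟ true) (λ j → V₁ j Bool.≟ true) i (false≢true e) (insert-here i U)
        (λ j u → trans (cong (⌊ j ≟ i ⌋ ∨_) u) (Bool.∨-zeroʳ _))
      fewer : suc (count (λ j → V₁ j Bool.≟ false)) ≤ count (λ j → U j Bool.≟ false)
      fewer = count-gain (λ j → V₁ j Bool.≟ false) (λ j → U j Bool.≟ false) i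
        (λ f → proj₁ (insert-false i U i f) refl) e (λ j f → proj₂ (insert-false i U j f))
      rest : X ∸ a ≤ count (outside? V₁)
      rest = m≤n+o⇒m∸n≤o X a (≤-trans cover (≤-trans (count-∪ (outside? U) (outside? V₁) (P? i) covers)
        (≤-reflexive (+-comm _ a))))
        where
        covers : ∀ g → (Σ (Fin k) λ j → U j ≡ false × P j g) → (Σ (Fin k) λ j → V₁ j ≡ false × P j g) ⊎ P i g
        covers g (j , f , p) with j ≟ i
        ... | yes refl = inj₂ p
        ... | no ne    = inj₁ (j , trans (insert-other i U j ne) f , p)
      split : ∀ r → count (λ j → U j Bool.≟ false) ≤ r → Dec (X ≤ 2 * a) → Popular U X
      split _ _ (yes big) = V₁ , 1 , ≤-refl , ≤-trans (≤-reflexive (+-comm _ 1)) bigger ,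
        (λ j v → [ (λ { refl → inj₂ big }) , inj₁ ]′ (insert-true i U j v)) , i , e , big
      split zero none (no _) with () ← ≤-trans fewer none
      split (suc r) some (no small) = extend (popular r V₁ (X ∸ a) (≤-pred (≤-trans fewer some))
          (m<n⇒0<n∸m a<X) rest)
        where
        2a<X = ≰⇒> small
        a<X : a < X
        a<X = ≤-<-trans (m≤m+n a (a + 0)) 2a<X
        double : X ≤ 2 * (X ∸ a)
        double = linear 0 (+-mono-≤ (<⇒≤ 2a<X) (≤-reflexive (cong (2 *_) (sym (m∸n+n≡m (<⇒≤ a<X))))))
          (arith X a (X ∸ a))
          where
          arith : ∀ x a y → x + (x + 2 * (y + a)) + 0 ≡ 2 * y + (2 * a + 2 * x)
          arith = solve-∀
        lift : ∀ t {b} → X ∸ a ≤ 2 ^ t * b → X ≤ 2 ^ suc t * b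
        lift t {b} le = ≤-trans double (≤-trans (*-monoʳ-≤ 2 le) (≤-reflexive (sym (*-assoc 2 (2 ^ t) b))))
        extend : Popular V₁ (X ∸ a) → Popular U X
        extend (V , t , 1≤t , sz , all , (j , f , w)) = V , suc t , s≤s z≤n ,
          ≤-trans (≤-reflexive (+-suc _ t)) (≤-trans (+-monoˡ-≤ t bigger) sz) ,
          (λ l v → [ (λ o → [ (λ { refl → inj₂ most }) , inj₁ ]′ (insert-true i U l o)) , (λ x → inj₂ (lift t x)) ]′ (all l v)) ,
          i , e , most
          where
          -- The colour `i` is at least as frequent as the colour `j` found among the others, so it
          -- meets the same bound.
          most : X ≤ 2 ^ suc t * a
          most = ≤-trans (lift t w) (*-monoʳ-≤ (2 ^ suc t) (top j (proj₂ (insert-false i U j f))))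

-- Gaining colours, and the recursion on levels and colours

module Strategy {n k : ℕ} (W : Fin n) (p₀ : Fin k) where
  open Tallies {n} {k} W
  open Phases {n} {k} W p₀
  open Local

  module _ (c : ℕ) (U : Fin k → Bool) where

    settled : Local {n} {k}
    settled = saturated c U ∨ᴸ foreign U

    -- A saturated vertex sees all of `U`, so painting it makes its class foreign; foreign classes
    -- remain foreign.
    settled-paint : ∀ {p v i pl g} → Holds settled p g → Holds settled (paintP p v i pl) g
    settled-paint {p} {v} {i} {pl} (inj₂ (x , cx , j , f , e)) =
      inj₂ (x , cx , j , f , paint-just {s = st p} (proj₁ pl) e)
    settled-paint {p} {v} {i} {pl} {g} (inj₁ (x , cx , ux , lx , full)) = split (x ≟ v)
      where
      q = paintP p v i pl
      split : Dec (x ≡ v) → Holds settled q g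
      split (no ne) = inj₁ (x , cx , trans (paint-else (st p) ne) ux ,
        ≤-trans lx (level-mono {s = st p} {st q} (λ _ → Sees-paint {s = st p} (proj₁ pl))) ,
        λ j t → Sees-paint {s = st p} (proj₁ pl) (full j t))
      split (yes refl) = inj₂ (x , cx , i , new (U i) refl , paint-here (st p) v i)
        where
        new : ∀ b → U i ≡ b → b ≡ false
        new false _ = refl
        new true  t = ⊥-elim (unseen {s = st p} {v} pl (full i t))

    -- While Builder passes, Painter can touch saturated vertices only with colours outside U.
    waiting : ∀ X B → 1 ≤ X → (∀ q → Funded p₀ q → Supplied U B q → X ≤ tally (saturated c U) q → X ≤ tally (foreign U) q → Win (st q)) →
      ∀ j p → uncs (st p) ≤ j → Funded p₀ p → Supplied U B p → X ≤ tally (saturated c U) p →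
      2 * X ≤ tally settled p → Win (st p)
    waiting X B 1≤X after j p le fd sup sat set = decide (tally (saturated c U) p ≤? X)
      where
      decide : Dec (tally (saturated c U) p ≤ X) → Win (st p)
      -- The saturated tally drops by at most one per round, so waiting stops with exactly `X`
      -- saturated classes, and the rest of the `2 * X` settled ones are foreign.
      decide (yes few) = after p fd sup sat (+-cancelˡ-≤ X X _ (begin
        X + X                                             ≡⟨ cong (X +_) (sym (+-identityʳ X)) ⟩
        2 * X                                             ≤⟨ set ⟩
        tally settled p                                   ≤⟨ tally-∪ settled (saturated c U) (foreign U) {p} (λ _ → id) ⟩
        tally (saturated c U) p + tally (foreign U) p     ≤⟨ +-monoˡ-≤ _ few ⟩
        X + tally (foreign U) p                           ∎))
        where open ≤-Reasoning
      decide (no more) = turn (λ v i pl → step v i pl j le)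
        where
        step : ∀ v i (pl : PainterLegal (st p) v i) j → uncs (st p) ≤ j → Next (paint (st p) v i)
        step v i pl zero none with () ← ≤-trans (uncs-paint {s = st p} {v} {i} (proj₁ pl)) none
        step v i pl (suc j) some = move-pass p₀ {p₁} alive (rich p₀ {p} {v} {i} {pl} fd) (λ {u} {w} {ec} {es} {nc} → continue {u} {w} {ec} {es} {nc})
          where
          p₁ = paintP p v i pl
          sat₁ : X ≤ tally (saturated c U) p₁
          sat₁ = ≤-pred (≤-trans (≰⇒> more) (tally-paint (saturated c U) {p} {v} {i} {pl}))
          alive : ∃ (Unc (st p₁))
          alive = let _ , _ , x , _ , ux , _ = tally-∃ (saturated c U) {p₁} (≤-trans 1≤X sat₁) in x , ux
          continue : ∀ {u w ec es nc} → comp p₁ u ≡ W → Funded p₀ (passP p₁ u w ec es nc) → Win (st (passP p₁ u w ec es nc))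
          continue {u} {w} {ec} {es} {nc} inW fd₂ = waiting X B 1≤X after j (passP p₁ u w ec es nc)
            (≤-pred (≤-trans (uncs-paint {s = st p} {v} {i} (proj₁ pl)) some)) fd₂
            (λ l t → ≤-trans (sup l t) (≤-trans
              (tally-mono (supply l) (supply l) {p} {p₁} (λ { _ _ (x , cx , e) → x , cx , paint-just {s = st p} (proj₁ pl) e }))
              (tally-pass (supply l) {p₁} {u} {w} {ec} {es} {nc} inW)))
            (≤-trans sat₁ (tally-pass (saturated c U) {p₁} {u} {w} {ec} {es} {nc} inW))
            (≤-trans set (≤-trans (tally-mono settled settled {p} {p₁} (λ _ _ → settled-paint {p} {v} {i} {pl}))
              (tally-pass settled {p₁} {u} {w} {ec} {es} {nc} inW)))

  -- Levels still missing plus colours not yet in `U`; a vertex of level `k` is stuck.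
  budget : ℕ → (Fin k → Bool) → ℕ
  budget c U = (k ∸ c) + (k ∸ size U)

  -- The summand `k` in the exponent keeps every pool at least `2 ^ k`, as the pigeonhole on colour
  -- sets requires.
  pool : ℕ → ℕ
  pool b = 2 ^ (10 * b + (k + 10))

  pool-mono : ∀ {a b} → a ≤ b → pool a ≤ pool b
  pool-mono le = ^-monoʳ-≤ 2 (+-monoˡ-≤ (k + 10) (*-monoʳ-≤ 10 le))

  pool-suc : ∀ b → pool (suc b) ≡ 1024 * pool b
  pool-suc b = trans (cong (2 ^_) (arith b k)) (^-distribˡ-+-* 2 10 (10 * b + (k + 10)))
    where
    arith : ∀ b k → 10 * suc b + (k + 10) ≡ 10 + (10 * b + (k + 10))
    arith = solve-∀

  1≤pool : ∀ b → 1 ≤ pool b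
  1≤pool b = m^n>0 2 (10 * b + (k + 10))

  2^k≤pool : ∀ b → 2 ^ k ≤ pool b
  2^k≤pool b = ^-monoʳ-≤ 2 (≤-trans (m≤m+n k 10) (m≤n+m (k + 10) (10 * b)))

  -- Gaining `t` colours divides frequencies by up to `2 ^ t` but saves `10 * t` in the exponent:
  -- `t` + 10 - 10 `t` is at most 1, well below 8.
  pool-drop : ∀ b t → 1 ≤ t → t ≤ suc b → 2 ^ t * pool (suc b ∸ t) ≤ 256 * pool b
  pool-drop b t 1≤t t≤ = ≤-trans (≤-reflexive (sym (^-distribˡ-+-* 2 t (10 * (suc b ∸ t) + (k + 10)))))
    (≤-trans (^-monoʳ-≤ 2 ex) (≤-reflexive (^-distribˡ-+-* 2 8 (10 * b + (k + 10)))))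
    where
    ex : t + (10 * (suc b ∸ t) + (k + 10)) ≤ 8 + (10 * b + (k + 10))
    ex = linear 7 (+-mono-≤ (*-monoʳ-≤ 9 1≤t) (≤-reflexive (cong (10 *_) (m∸n+n≡m t≤))))
      (arith t (suc b ∸ t) b k)
      where
      arith : ∀ t d b k → t + (10 * d + (k + 10)) + (9 * t + 10 * suc b) + 7
        ≡ 8 + (10 * b + (k + 10)) + (9 * 1 + 10 * (d + t))
      arith = solve-∀

  finish : ∀ {c p} → k ≤ c → 1 ≤ tally (high c) p → Win (st p)
  finish {c} {p} k≤c some with _ , _ , x , _ , ux , lx ← tally-∃ (high c) {p} some =
    bstuck (x , ux , λ i → decidable-stable (sees? (st p) x i) (λ ¬s → <-irrefl refl (≤-trans
      (≤-trans (s≤s (≤-trans k≤c lx)) (count-gain {Q = λ _ → ⊤} (sees? (st p) x) (λ _ → yes tt) i ¬s tt (λ _ _ → tt)))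
      (count-≤ {P = λ (_ : Fin k) → ⊤} (λ _ → yes tt)))))

  -- Each step costs a factor 2 ^ 10 per unit of budget: a level, or one more colour in good supply.
  main : ∀ f b → b ≤ f → ∀ c U p → Funded p₀ p → budget c U ≤ b → pool b ≤ tally (high c) p →
    Supplied U (pool b) p → Win (st p)
  main f zero _ c U p fd le many sup = finish {c} {p} (m∸n≡0⇒m≤n (n≤0⇒n≡0 (≤-trans (m≤m+n _ _) le)))
    (≤-trans (1≤pool 0) many)
  main (suc f) (suc b) (s≤s b≤f) c U p fd le many sup = decide (k ≤? c)
    where
    m = pool b
    next-level : k ≰ c → ∀ q → Funded p₀ q → Supplied U m q → m ≤ tally (high (suc c)) q → Win (st q)
    next-level k≰c q fd sup many = main f b b≤f (suc c) U q fd
      (≤-pred (≤-trans (≤-reflexive (cong (_+ (k ∸ size U)) (sym (+-∸-assoc 1 (≰⇒> k≰c))))) le)) many sup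

    stage₁ : k ≰ c → 512 * m ≤ tally (lacking c U) p → Win (st p)
    -- The target `64 * m` is reached in at most `64 * m` rounds. The reserves fit: 256 + 64 + 3 *
    -- 64 = 512 for the lacking classes and 832 + 3 * 64 = 1024 for the supplies.
    stage₁ k≰c half = pairing c U (256 * m) (64 * m) (832 * m)
        (≤-trans (s≤s (2^k≤pool b)) (≤-trans (+-monoˡ-≤ m (1≤pool b)) (≤-trans (≤-reflexive (double m)) (*-monoˡ-≤ m (m≤m+n 2 254)))))
        after (64 * m) p fd (≤-trans (≤-reflexive (e₁ m)) half)
        (λ i t → ≤-trans (≤-reflexive (trans (e₂ m) (sym (pool-suc b)))) (sup i t)) (m≤m+n _ _)
      where
      double : ∀ m → m + m ≡ 2 * m
      double = solve-∀
      e₁ : ∀ m → 256 * m + 64 * m + 3 * (64 * m) ≡ 512 * m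
      e₁ = solve-∀
      e₂ : ∀ m → 832 * m + 3 * (64 * m) ≡ 1024 * m
      e₂ = solve-∀
      after : ∀ q → Funded p₀ q → Supplied U (832 * m) q → 64 * m ≤ worth (paired c U) (promising c U) q → Win (st q)
      after q fd sup wor = split (m ≤? tally (high (suc c)) q)
        where
        lower : ∀ {a} → m ≤ suc a * m
        lower {a} = m≤m+n m (a * m)
        split : Dec (m ≤ tally (high (suc c)) q) → Win (st q)
        split (yes done) = next-level k≰c q fd (λ i t → ≤-trans (lower {831}) (sup i t)) done
        -- Worth is paired plus promising, and promising is at most paired plus high. With high
        -- below `m`, twice the paired tally is at least `63 * m`, whereas `2 * m` rounds need only
        -- `7 * m` paired classes.
        split (no few) = strengthening c U m (826 * m) (lower {825})
          (λ q fd sup → next-level k≰c q fd (λ i t → ≤-trans (lower {825}) (sup i t)))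
          (2 * m) q fd (*-cancelˡ-≤ 2 (linear (49 * m) (+-mono-≤ wor (+-mono-≤
            (tally-∪ (promising c U) (paired c U) (high (suc c)) {q} (λ _ → id)) (≰⇒≥ few)))
            (e₄ m (tally (paired c U) q) (tally (promising c U) q) (tally (high (suc c)) q))))
          (λ i t → ≤-trans (≤-reflexive (e₃ m)) (sup i t)) (m≤m+n _ _)
          where
          e₃ : ∀ m → 826 * m + 3 * (2 * m) ≡ 832 * m
          e₃ = solve-∀
          e₄ : ∀ m x y z → 2 * (m + 3 * (2 * m)) + (x + y + (x + z + m)) + 49 * m ≡ 2 * x + (64 * m + (y + z))
          e₄ = solve-∀

    stage₂ : 512 * m ≤ tally (saturated c U) p → Win (st p)
    stage₂ half = waiting c U (256 * m) (pool (suc b)) (≤-trans (1≤pool b) (m≤m+n m (255 * m))) after (uncs (st p)) p ≤-refl fd sup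
        (≤-trans (*-monoˡ-≤ m (m≤m+n 256 256)) half)
        (≤-trans (≤-trans (≤-reflexive (e m)) half) (tally-mono (saturated c U) (settled c U) {p} {p} (λ _ _ → inj₁)))
      where
      e : ∀ m → 2 * (256 * m) ≡ 512 * m
      e = solve-∀
      after : ∀ q → Funded p₀ q → Supplied U (pool (suc b)) q → 256 * m ≤ tally (saturated c U) q →
        256 * m ≤ tally (foreign U) q → Win (st q)
      after q fd sup sat new = grow-U (popular {P = λ i g → g ≢ W × Holds (supply i) q g}
          (λ i g → ¬? (g ≟ W) ×-dec holds? (supply i) q g) _ U (256 * m) ≤-refl (≤-trans (1≤pool b) (m≤m+n m (255 * m)))
          (≤-trans new (count-mono (λ g → ¬? (g ≟ W) ×-dec holds? (foreign U) q g)
            (outside? (λ i g → ¬? (g ≟ W) ×-dec holds? (supply i) q g) U)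
            (λ { g (ne , x , cx , i , f , ex) → i , f , ne , x , cx , ex }))))
        where
        grow-U : Popular (λ i g → ¬? (g ≟ W) ×-dec holds? (supply i) q g) U (256 * m) → Win (st q)
        -- The level stays `c`, with the saturated classes as the high ones. Colours of `U` keep
        -- their supply, and `pool-drop` shows that the new ones occur often enough for the budget
        -- reduced by `t`.
        grow-U (V , t , 1≤t , sz , all , _) = main f (suc b ∸ t) (≤-trans t-small b≤f) c V q fd cost
            (≤-trans (pool-mono t-small) (≤-trans (m≤m+n m (255 * m)) (≤-trans sat
              (tally-mono (saturated c U) (high c) {q} {q} (λ { _ _ (x , cx , ux , lx , _) → x , cx , ux , lx })))))
            (λ i v → [ (λ u → ≤-trans (pool-mono (m∸n≤m (suc b) t)) (sup i u))
                     , (λ big → *-cancelˡ-≤ (2 ^ t) {{m^n≢0 2 t}} (≤-trans (pool-drop b t 1≤t t≤) big)) ]′ (all i v))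
          where
          t-small : suc b ∸ t ≤ b
          t-small = ∸-monoʳ-≤ (suc b) 1≤t
          t≤U : t ≤ k ∸ size U
          t≤U = m+n≤o⇒m≤o∸n t (≤-trans (≤-reflexive (+-comm t _)) (≤-trans sz (count-≤ (λ i → V i Bool.≟ true))))
          t≤ : t ≤ suc b
          t≤ = ≤-trans t≤U (≤-trans (m≤n+m _ (k ∸ c)) le)
          cost : budget c V ≤ suc b ∸ t
          cost = begin
            (k ∸ c) + (k ∸ size V)         ≤⟨ +-monoʳ-≤ (k ∸ c) (∸-monoʳ-≤ k sz) ⟩
            (k ∸ c) + (k ∸ (size U + t))   ≡⟨ cong ((k ∸ c) +_) (sym (∸-+-assoc k (size U) t)) ⟩
            (k ∸ c) + (k ∸ size U ∸ t)     ≡⟨ sym (+-∸-assoc (k ∸ c) t≤U) ⟩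
            budget c U ∸ t                 ≤⟨ ∸-monoˡ-≤ t le ⟩
            suc b ∸ t                      ∎
            where open ≤-Reasoning

    decide : Dec (k ≤ c) → Win (st p)
    decide (yes k≤c) = finish {c} {p} k≤c (≤-trans (1≤pool (suc b)) many)
    decide (no k≰c) = halves (512 * m ≤? tally (lacking c U) p)
      where
      either : ∀ g → Holds (high c) p g → Holds (lacking c U) p g ⊎ Holds (saturated c U) p g
      either g (x , cx , ux , lx) with lacks? U (st p) x
      ... | yes l = inj₁ (x , cx , ux , lx , l)
      ... | no ¬l = inj₂ (x , cx , ux , lx , λ i t → decidable-stable (sees? (st p) x i) (λ ¬s → ¬l (i , t , ¬s)))
      halves : Dec (512 * m ≤ tally (lacking c U) p) → Win (st p)
      halves (yes half) = stage₁ k≰c half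
      halves (no few) = stage₂ (+-cancelˡ-≤ (512 * m) _ _ (begin
        512 * m + 512 * m                                        ≡⟨ e₀ m ⟩
        1024 * m                                                 ≡⟨ sym (pool-suc b) ⟩
        pool (suc b)                                             ≤⟨ many ⟩
        tally (high c) p                                         ≤⟨ tally-∪ (high c) (lacking c U) (saturated c U) {p} either ⟩
        tally (lacking c U) p + tally (saturated c U) p          ≤⟨ +-monoˡ-≤ _ (≰⇒≥ few) ⟩
        512 * m + tally (saturated c U) p                        ∎))
        where
        open ≤-Reasoning
        e₀ : ∀ m → 512 * m + 512 * m ≡ 1024 * m
        e₀ = solve-∀

-- The opening: preparing the passes in a single class

start : ∀ {n k} → Position n k
start = record
  { st = initial ; comp = id ; side = λ _ → true ; edge = λ _ _ () ; mirror = λ _ _ () ; proper = λ _ _ _ () }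

-- Outside the label w₀ all vertices stay isolated until enough passes are stored.
module Opening {n k : ℕ} (w₀ : Fin n) where
  open Tallies {n} {k} w₀
  open Local

  record Star (p : Position n k) : Set where
    field
      centre : comp p w₀ ≡ w₀
      single : ∀ x → comp p x ≢ w₀ → comp p x ≡ x
  open Star

  Arms : Position n k → Set
  Arms p = ∀ x → comp p x ≡ w₀ → x ≡ w₀ ⊎ adj (st p) x w₀ ≡ true

  star-paint : ∀ {p v i pl} → Star p → Star (paintP p v i pl)
  star-paint S = record { centre = centre S ; single = single S }

  star-link : ∀ {p u v ne nc} → Star p → comp p u ≡ w₀ → comp p v ≢ w₀ → Star (linkP p u v ne nc)
  star-link {p} {u} {v} S inW out = record
    { centre = trans (relabel-kept p u v (λ e → out (trans (sym e) (centre S)))) (centre S)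
    ; single = alone }
    where
    alone : ∀ x → relabel p u v x ≢ w₀ → relabel p u v x ≡ x
    alone x ne = split (comp p x ≟ comp p v)
      where
      split : Dec (comp p x ≡ comp p v) → relabel p u v x ≡ x
      split (yes e) = ⊥-elim (ne (trans (relabel-moved p u v e) inW))
      split (no k)  = trans (relabel-kept p u v k) (single S x (λ e → ne (trans (relabel-kept p u v k) e)))

  isolated : ∀ {p x y} → Star p → comp p x ≢ w₀ → adj (st p) x y ≢ true
  isolated {p} {x} {y} S out a = proj₂ (edge p x y a) (cong (side p) x≡y)
    where
    same = proj₁ (edge p x y a)
    x≡y : x ≡ y
    x≡y = trans (sym (single S x out)) (trans same (single S y (λ e → out (trans same e))))

  arms-link : ∀ {p v ne nc} → Star p → Arms p → comp p v ≢ w₀ → Arms (linkP p w₀ v ne nc)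
  arms-link {p} {v} S A out x e = split (comp p x ≟ comp p v)
    where
    split : Dec (comp p x ≡ comp p v) → x ≡ w₀ ⊎ adj (addEdge (st p) w₀ v) x w₀ ≡ true
    split (yes s) with refl ← trans (sym (single S x (λ f → out (trans (sym s) f)))) (trans s (single S v out)) =
      inj₂ (add-new˘ (st p) w₀ v)
    split (no k) = [ inj₁ , (λ a → inj₂ (add-old (st p) a)) ]′ (A x (trans (sym (relabel-kept p w₀ v k)) e))

  fresh : ∀ {p} → 1 ≤ tally (high 0) p → ∃ λ v → comp p v ≢ w₀ × Unc (st p) v
  fresh {p} le with g , ne , v , c , u , _ ← tally-∃ (high 0) {p} le = v , (λ e → ne (trans (sym c) e)) , u

  -- Harmless moves until Painter has coloured R vertices, so that some colour is frequent.
  spokes : ∀ R F → (∀ q → Star q → Arms q → F ≤ tally (high 0) q → uncs (st q) + R ≤ n → Win (st q)) →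
    ∀ r p → Star p → Arms p → F + 3 * r ≤ tally (high 0) p → uncs (st p) + R ≤ n + r → Win (st p)
  spokes R F after zero p S A src un = after p S A (≤-trans (m≤m+n F 0) src) (≤-trans un (≤-reflexive (+-identityʳ n)))
  spokes R F after (suc r) p S A src un = turn reply
    where
    reply : ∀ v i → PainterLegal (st p) v i → Next (paint (st p) v i)
    reply v i pl = join (fresh {p₁} (≤-trans (s≤s z≤n) (surplus 0 F r src (tally-paint (high 0) {p} {v} {i} {pl})
        (≤-reflexive (sym (+-identityʳ _))) z≤n)))
      where
      p₁ = paintP p v i pl
      join : (∃ λ x → comp p₁ x ≢ w₀ × Unc (st p₁) x) → Next (st p₁)
      join (x , out , ux) = move-link {p₁} {w₀} {x} {ne} {nc} (x , ux)
        (spokes R F after r (linkP p₁ w₀ x ne nc)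
          (star-link {p₁} {w₀} {x} {ne} {nc} (star-paint {p} {v} {i} {pl} S) (centre S) out)
          (arms-link {p₁} {x} {ne} {nc} (star-paint {p} {v} {i} {pl} S) A out)
          (lose-three F r src (tally-paint (high 0) {p} {v} {i} {pl}) (tally-link (high 0) {p₁} {w₀} {x} {ne} {nc}))
          (≤-pred (≤-trans (+-monoˡ-≤ R (uncs-paint {s = st p} {v} {i} (proj₁ pl))) (≤-trans un (≤-reflexive (+-suc n r))))))
        where
        ne : comp p₁ w₀ ≢ comp p₁ x
        ne e = out (trans (sym e) (centre S))
        nc : ¬ SameColour (st p₁) w₀ x
        nc (_ , _ , e) = unc-not-just {s = st p₁} ux e

  -- All coloured vertices receive the label `w₀`. Those outside the star are isolated, so their
  -- side is free; it is chosen opposite to the centre, where the arms already are.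
  absorb : (p : Position n k) → Star p → Position n k
  absorb p S = record
    { st = st p ; comp = comp′ ; side = side′ ; mirror = mirror p ; proper = proper p ; edge = edge′ }
    where
    comp′ : Fin n → Fin n
    comp′ x = if does (unc? (st p) x) then comp p x else w₀
    side′ : Fin n → Bool
    side′ x = if ⌊ comp p x ≟ w₀ ⌋ then side p x else not (side p w₀)
    edge′ : ∀ x y → adj (st p) x y ≡ true → comp′ x ≡ comp′ y × side′ x ≢ side′ y
    edge′ x y a with comp p x ≟ w₀ | comp p y ≟ w₀
    ... | no out | _      = ⊥-elim (isolated {p} S out a)
    ... | yes _  | no out = ⊥-elim (isolated {p} S out (mirror p x y a))
    ... | yes cx | yes cy = trans (inW x cx) (sym (inW y cy)) , proj₂ (edge p x y a)
      where
      inW : ∀ x → comp p x ≡ w₀ → comp′ x ≡ w₀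
      inW x e with unc? (st p) x
      ... | yes _ = e
      ... | no _  = refl

  module _ {p : Position n k} (S : Star p) where
    private
      q = absorb p S

    absorb-unc : ∀ {x} → Unc (st p) x → comp q x ≡ comp p x
    absorb-unc {x} u with unc? (st p) x
    ... | yes _ = refl
    ... | no ¬u = ⊥-elim (¬u u)

    absorb-col : ∀ {x} → ¬ Unc (st p) x → comp q x ≡ w₀
    absorb-col {x} ¬u with unc? (st p) x
    ... | yes u = ⊥-elim (¬u u)
    ... | no _  = refl

    absorb-star : Star q
    absorb-star = record { centre = mid ; single = alone }
      where
      mid : comp q w₀ ≡ w₀
      mid with unc? (st p) w₀
      ... | yes _ = centre S
      ... | no _  = refl
      alone : ∀ x → comp q x ≢ w₀ → comp q x ≡ x
      alone x ne with unc? (st p) x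
      ... | yes _ = single S x ne
      ... | no _  = ⊥-elim (ne refl)

    absorb-tally : tally (high 0) p ≤ tally (high 0) q
    absorb-tally = tally-mono (high 0) (high 0) {p} {q} (λ { g _ (x , cx , ux , l) → x , trans (absorb-unc ux) cx , ux , l })

    absorb-side : ∀ {x} → Arms p → x ≢ w₀ → side q x ≡ not (side p w₀)
    absorb-side {x} A ne with comp p x ≟ w₀
    ... | no _  = refl
    ... | yes c with A x c
    ... | inj₁ e = ⊥-elim (ne e)
    ... | inj₂ a = Bool.¬-not (proj₂ (edge p x w₀ a))

  module _ (p₀ : Fin k) (h₀ : Fin n) where

    -- A vertex newly joined to the hub `h₀` sees `p₀` and lies on the side opposite to `h`, so it
    -- forms a pass with every such `h`.
    Target : Position n k → Fin n → Set
    Target p h = h ≢ h₀ × comp p h ≡ w₀ × col (st p) h ≡ just p₀ × side p h ≡ side p h₀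

    target? : ∀ p → Decidable (Target p)
    target? p h = ¬? (h ≟ h₀) ×-dec (comp p h ≟ w₀) ×-dec maybe-≡-dec _≟_ (col (st p) h) (just p₀)
      ×-dec (side p h Bool.≟ side p h₀)

    record Hub (p : Position n k) : Set where
      field
        star  : Star p
        hubW  : comp p h₀ ≡ w₀
        hubC  : col (st p) h₀ ≡ just p₀
    open Hub

    hub-paint : ∀ {p v i pl} → Hub p → Hub (paintP p v i pl)
    hub-paint {p} {v} {i} {pl} H = record
      { star = star-paint {p} {v} {i} {pl} (star H) ; hubW = hubW H ; hubC = paint-just {s = st p} (proj₁ pl) (hubC H) }

    module _ {p : Position n k} {v : Fin n} {ne : comp p h₀ ≢ comp p v} {nc : ¬ SameColour (st p) h₀ v}
      (H : Hub p) (out : comp p v ≢ w₀) where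
      private
        q = linkP p h₀ v ne nc

      away : ∀ {x} → comp p x ≡ w₀ → comp p x ≢ comp p v
      away e f = out (trans (sym f) e)

      hub-link : Hub q
      hub-link = record
        { star = star-link {p} {h₀} {v} {ne} {nc} (star H) (hubW H) out
        ; hubW = trans (relabel-kept p h₀ v ne) (hubW H) ; hubC = hubC H }

      target-link : ∀ h → Target p h → Target q h
      target-link h (a , b , c , d) = a , trans (relabel-kept p h₀ v (away b)) b , c ,
        trans (reside-kept p h₀ v (away b)) (trans d (sym (reside-kept p h₀ v ne)))

      stored : ∀ h → Target p h → Pass p₀ q v h
      stored h T@(a , b , c , d) with a′ , b′ , c′ , d′ ← target-link h T =
        trans (relabel-moved p h₀ v refl) (hubW H) , b′ ,
        (λ e → proj₂ (edge q h₀ v (add-new (st p) h₀ v)) (trans (sym d′) (sym e))) ,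
        non-adjacent {addEdge (st p) h₀ v} fresh-pair , c , (h₀ , add-new˘ (st p) h₀ v , hubC H)
        where
        fresh-pair : adj (addEdge (st p) h₀ v) v h ≢ true
        fresh-pair e with add⁻ (st p) {h₀} {v} e
        ... | inj₁ o                = isolated {p} (star H) out o
        ... | inj₂ (inj₁ (_ , f))   = away b (cong (comp p) f)
        ... | inj₂ (inj₂ (_ , f))   = a f

      passes-stored : ∀ {η} → η ≤ count (target? p) → passes p₀ p + η ≤ passes p₀ q
      passes-stored {η} le = subst (passes p₀ p + η ≤_) (+-identityʳ _)
        (∑-trade (λ x → count (pass? p₀ p x)) (λ x → count (pass? p₀ q x)) v 0 η
          (λ x _ → count-mono (pass? p₀ p x) (pass? p₀ q x) (λ h → pass-link p₀ {p} {h₀} {v} {ne} {nc} out x h))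
          (≤-trans (+-mono-≤ (≤-reflexive (count-none (pass? p₀ p v) (λ h (c , _) → out c))) le)
            (≤-trans (count-mono (target? p) (pass? p₀ q v) stored) (≤-reflexive (sym (+-identityʳ _))))))

    -- Each round joins a fresh isolated vertex to the hub, which stores one pass for each of at
    -- least `η` targets.
    storing : ∀ M η F → (∀ q → F ≤ tally (high 0) q → M * η ≤ passes p₀ q → Win (st q)) →
      ∀ r p → Hub p → η ≤ count (target? p) → F + 3 * r ≤ tally (high 0) p → M * η ≤ passes p₀ p + r * η → Win (st p)
    storing M η F after zero p H tg src ps = after p (≤-trans (m≤m+n F 0) src) (≤-trans ps (≤-reflexive (+-identityʳ _)))
    storing M η F after (suc r) p H tg src ps = turn reply
      where
      reply : ∀ v i → PainterLegal (st p) v i → Next (paint (st p) v i)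
      reply v i pl = join (fresh {p₁} (≤-trans (s≤s z≤n) (surplus 0 F r src (tally-paint (high 0) {p} {v} {i} {pl})
          (≤-reflexive (sym (+-identityʳ _))) z≤n)))
        where
        p₁ = paintP p v i pl
        H₁ : Hub p₁
        H₁ = hub-paint {p} {v} {i} {pl} H
        tg₁ : η ≤ count (target? p₁)
        tg₁ = ≤-trans tg (count-mono (target? p) (target? p₁)
          (λ h (a , b , c , d) → a , b , paint-just {s = st p} (proj₁ pl) c , d))
        join : (∃ λ x → comp p₁ x ≢ w₀ × Unc (st p₁) x) → Next (st p₁)
        join (x , out , ux) = move-link {p₁} {h₀} {x} {ne} {nc} (x , ux)
          (storing M η F after r (linkP p₁ h₀ x ne nc) (hub-link {p₁} {x} {ne} {nc} H₁ out)
            (≤-trans tg₁ (count-mono (target? p₁) (target? (linkP p₁ h₀ x ne nc)) (target-link {p₁} {x} {ne} {nc} H₁ out)))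
            (lose-three F r src (tally-paint (high 0) {p} {v} {i} {pl}) (tally-link (high 0) {p₁} {h₀} {x} {ne} {nc}))
            (≤-trans ps (≤-trans (+-monoˡ-≤ _ (passes-paint p₀ {p} {v} {i} {pl}))
              (≤-trans (≤-reflexive (sym (+-assoc _ η (r * η))))
                (+-monoˡ-≤ (r * η) (passes-stored {p₁} {x} {ne} {nc} H₁ out tg₁))))))
          where
          ne : comp p₁ h₀ ≢ comp p₁ x
          ne e = out (trans (sym e) (hubW H₁))
          nc : ¬ SameColour (st p₁) h₀ x
          nc (_ , _ , e) = unc-not-just {s = st p₁} ux e

  module _ (R F : ℕ) (2≤R : 2 ≤ R) (enough : ∀ H → R ≤ suc (2 ^ k * suc H) → n ≤ 2 ^ (k + 5) * H)
    (play : ∀ p₀ q → F ≤ tally (high 0) q → Funded p₀ q → Win (st q)) where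

    Coloured : Position n k → Fin k → Fin n → Set
    Coloured q i x = x ≢ w₀ × col (st q) x ≡ just i

    coloured? : ∀ q i → Decidable (Coloured q i)
    coloured? q i x = ¬? (x ≟ w₀) ×-dec maybe-≡-dec _≟_ (col (st q) x) (just i)

    stock : ∀ q → Star q → Arms q → F + 3 * 2 ^ (k + 5) ≤ tally (high 0) q → uncs (st q) + R ≤ n → Win (st q)
    -- At least `R` vertices are coloured; one is subtracted because the centre `w₀`, which lies on
    -- the other side, cannot be a target.
    stock q S A src un = chosen (popular {P = Coloured q} (coloured? q) _ none (R ∸ 1) ≤-refl (m<n⇒0<n∸m 2≤R)
        (m≤n+o⇒m∸n≤o R 1 (+-cancelˡ-≤ (uncs (st q)) R _ (≤-trans un (≤-trans
          (≤-reflexive (sym (count-compl (unc? (st q)))))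
          (+-monoʳ-≤ (uncs (st q)) (count-lose (λ x → ¬? (unc? (st q) x)) (outside? (coloured? q) none) w₀ seen)))))))
      where
      none : Fin k → Bool
      none _ = false
      seen : ∀ x → x ≢ w₀ → ¬ Unc (st q) x → Σ (Fin k) λ i → none i ≡ false × Coloured q i x
      seen x ne ¬u = let i , e = coloured {s = st q} ¬u in i , refl , ne , e
      chosen : Popular (coloured? q) none (R ∸ 1) → Win (st q)
      chosen (V , t , _ , sz , _ , p₀ , _ , big) = hub (count-∃ (coloured? q p₀) some)
        where
        H = count (coloured? q p₀)
        big′ : R ∸ 1 ≤ 2 ^ k * H
        big′ = ≤-trans big (*-monoˡ-≤ H (^-monoʳ-≤ 2 (≤-trans (m≤n+m t _) (≤-trans sz (count-≤ (λ i → V i Bool.≟ true))))))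
        some : 1 ≤ H
        some with H | big′
        ... | suc _ | _ = s≤s z≤n
        ... | zero  | b with () ← ≤-trans (m<n⇒0<n∸m 2≤R) (≤-trans b (≤-reflexive (*-zeroʳ (2 ^ k))))
        hub : ∃ (Coloured q p₀) → Win (st q)
        hub (h₀ , h≢ , hc) = storing p₀ h₀ (2 ^ (k + 5)) η F after (2 ^ (k + 5)) (absorb q S)
          (record { star = absorb-star S ; hubW = absorb-col S (λ u → unc-not-just {s = st q} u hc) ; hubC = hc })
          ≤-refl (≤-trans src (absorb-tally S)) (m≤n+m _ _)
          where
          η = count (target? p₀ h₀ (absorb q S))
          H≤ : H ≤ suc η
          H≤ = count-lose (coloured? q p₀) (target? p₀ h₀ (absorb q S)) h₀
            (λ x ne (x≢ , e) → ne , absorb-col S (λ u → unc-not-just {s = st q} u e) , e ,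
              trans (absorb-side S A x≢) (sym (absorb-side S A h≢)))
          after : ∀ r → F ≤ tally (high 0) r → 2 ^ (k + 5) * η ≤ passes p₀ r → Win (st r)
          after r fr ps = play p₀ r fr (≤-trans (count-≤ (unc? (st r))) (≤-trans (enough η
            (≤-trans (m≤n+m∸n R 1) (s≤s (≤-trans big′ (*-monoʳ-≤ (2 ^ k) H≤))))) ps))

    opening : F + 3 * 2 ^ (k + 5) + 3 * R ≤ tally (high 0) start → Win (initial {n} {k})
    opening src = spokes R (F + 3 * 2 ^ (k + 5)) stock R start
      (record { centre = refl ; single = λ _ _ → refl }) (λ x e → inj₁ e) src
      (+-monoˡ-≤ R (count-≤ (unc? (initial {n} {k}))))

-- Choice of the constants and the theorem

start-tally : ∀ {n k} (w₀ : Fin n) → n ≤ suc (Tallies.tally {n} {k} w₀ (high 0) start)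
start-tally {n} {k} w₀ = subst (_≤ suc (count (λ g → ¬? (g ≟ w₀) ×-dec Local.holds? (high 0) (start {n} {k}) g)))
  (count-all {P = λ (_ : Fin n) → ⊤} (λ _ → yes tt) (λ _ → tt))
  (count-lose {P = λ _ → ⊤} (λ _ → yes tt) (λ g → ¬? (g ≟ w₀) ×-dec Local.holds? (high 0) (start {n} {k}) g) w₀
    (λ g ne _ → ne , g , refl , refl , z≤n))

builder-wins : ∀ n k → 1 ≤ k → 2 ^ (100 * k) ≤ n → BuilderWinsBipartite n k
builder-wins zero    k _ big with () ← ≤-trans (m^n>0 2 (100 * k)) big
builder-wins (suc n′) k 1≤k big = Opening.opening zero R F 2≤R enough play
    (≤-pred (≤-trans room (start-tally {n} {k} zero)))
  where
  n = suc n′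
  -- Three classes per round amount to at most 3 `n` / 8, and yet `R` coloured vertices provide `n`
  -- passes within `2 ^ (k + 5)` storing rounds.
  R = n / 8
  -- The pool for budget `k + k`, which covers all levels and all colours.
  F = 2 ^ (10 * (k + k) + (k + 10))
  M = 2 ^ (k + 5)
  -- A common bound for `2 ^ k`, `F` and `M`; since `k` is positive, `64 * Z` is still at most
  -- `2 ^ (100 * k)`.
  Z = 2 ^ (31 * k)
  8R≤n : 8 * R ≤ n
  8R≤n = ≤-trans (≤-reflexive (*-comm 8 R)) (m/n*n≤m n 8)
  n≤8R+7 : n ≤ 7 + 8 * R
  n≤8R+7 = ≤-trans (≤-reflexive (m≡m%n+[m/n]*n n 8)) (+-mono-≤ (≤-pred (m%n<n n 8)) (≤-reflexive (*-comm R 8)))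
  1≤Z : 1 ≤ Z
  1≤Z = m^n>0 2 (31 * k)
  2^k≤Z : 2 ^ k ≤ Z
  2^k≤Z = ^-monoʳ-≤ 2 (m≤m+n k (30 * k))
  F≤Z : F ≤ Z
  F≤Z = ^-monoʳ-≤ 2 (linear {X = 10 * (k + k) + (k + 10)} 0 (*-monoʳ-≤ 10 1≤k) (arith k))
    where
    arith : ∀ k → 10 * (k + k) + (k + 10) + 10 * k + 0 ≡ 31 * k + 10 * 1
    arith = solve-∀
  M≤Z : M ≤ Z
  M≤Z = ^-monoʳ-≤ 2 (linear {X = k + 5} (25 * k) (*-monoʳ-≤ 5 1≤k) (arith k))
    where
    arith : ∀ k → k + 5 + 5 * k + 25 * k ≡ 31 * k + 5 * 1
    arith = solve-∀
  64Z≤n : 64 * Z ≤ n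
  64Z≤n = ≤-trans (≤-reflexive (sym (^-distribˡ-+-* 2 6 (31 * k)))) (≤-trans
    (^-monoʳ-≤ 2 (linear {X = 6 + 31 * k} (63 * k) (*-monoʳ-≤ 6 1≤k) (arith k))) big)
    where
    arith : ∀ k → 6 + 31 * k + 6 * k + 63 * k ≡ 100 * k + 6 * 1
    arith = solve-∀
  64Z≤8R+7 : 64 * Z ≤ 7 + 8 * R
  64Z≤8R+7 = ≤-trans 64Z≤n n≤8R+7
  2≤R : 2 ≤ R
  2≤R = *-cancelˡ-≤ 8 (linear 41 (+-mono-≤ 64Z≤8R+7 (*-monoʳ-≤ 64 1≤Z)) (arith R Z))
    where
    arith : ∀ r z → 16 + (7 + 8 * r + 64 * z) + 41 ≡ 8 * r + (64 * z + 64)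
    arith = solve-∀
  enough : ∀ H → R ≤ suc (2 ^ k * suc H) → n ≤ M * H
  enough H le = ≤-trans (linear 100 (+-mono-≤ n≤8R+7 (+-mono-≤ (*-monoʳ-≤ 32 le) (+-mono-≤ (*-monoʳ-≤ 3 64Z≤8R+7)
      (+-mono-≤ (*-monoʳ-≤ 32 2^k≤Z) (*-monoʳ-≤ 160 1≤Z))))) (arith n R Z (2 ^ k) H))
    (≤-reflexive (trans (shift (2 ^ k) H) (cong (_* H) (sym (^-distribˡ-+-* 2 k 5)))))
    where
    arith : ∀ n r z a h → n + (7 + 8 * r + (32 * suc (a * suc h) + (3 * (7 + 8 * r) + (32 * z + 160 * z)))) + 100
      ≡ 32 * (a * h) + (n + (32 * r + (3 * (64 * z) + (32 * a + 160 * 1))))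
    arith = solve-∀
    shift : ∀ a h → 32 * (a * h) ≡ a * 32 * h
    shift = solve-∀
  room : suc (F + 3 * M + 3 * R) ≤ n
  room = *-cancelˡ-≤ 8 (linear (24 * Z + 4 * n) (+-mono-≤ (*-monoʳ-≤ 8 1≤Z) (+-mono-≤ (*-monoʳ-≤ 8 F≤Z)
      (+-mono-≤ (*-monoʳ-≤ 24 M≤Z) (+-mono-≤ (*-monoʳ-≤ 3 8R≤n) 64Z≤n)))) (arith F M R Z n))
    where
    arith : ∀ f m r z n → 8 * suc (f + 3 * m + 3 * r) + (8 * z + (8 * z + (24 * z + (3 * n + n)))) + (24 * z + 4 * n)
      ≡ 8 * n + (8 * 1 + (8 * f + (24 * m + (3 * (8 * r) + 64 * z))))
    arith = solve-∀
  play : ∀ p₀ q → F ≤ Tallies.tally zero (high 0) q → Tallies.Funded zero p₀ q → Win (st q)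
  -- With no colour in `U` the supply condition is vacuous and no vertex lacks a colour, so Builder
  -- begins by passing.
  play p₀ q many fd = Strategy.main zero p₀ (k + k) (k + k) ≤-refl 0 (λ _ → false) q fd
    (+-monoʳ-≤ k (m∸n≤m k (size (λ (_ : Fin k) → false)))) many (λ _ ())

binary-length : ∀ n → 1 ≤ n → ∃ λ j → 2 ^ j ≤ n × n < 2 ^ suc j
binary-length (suc zero) _ = 0 , ≤-refl , ≤-refl
binary-length (suc (suc n)) _ with j , lo , hi ← binary-length (suc n) (s≤s z≤n)
  with m≤n⇒m<n∨m≡n hi
... | inj₁ lt = j , ≤-trans lo (n≤1+n _) , lt
... | inj₂ eq = suc j , ≤-reflexive (sym eq) , subst (_< 2 ^ suc (suc j)) (sym eq) (^-monoʳ-< 2 (s≤s (s≤s z≤n)) {suc j} {suc (suc j)} ≤-refl)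

-- Logarithms are cleared: `2 ^ (k ∸ 1) ≤ n` is the upper bound for a winning `k`, and
-- `2 ^ (100 * k) ≤ n` says that `k` is at most 0.01 times the binary logarithm of `n`. Excluding
-- every such `k` bounds the minimum from below.
theorem1 : (n : ℕ) → 10 ^ 8 < n →
    (Σ ℕ λ k → 1 ≤ k × 2 ^ (k ∸ 1) ≤ n × PainterWins n k) ×
    ((k : ℕ) → 1 ≤ k → 2 ^ (100 * k) ≤ n → ¬ PainterWins n k) ×
    ((k : ℕ) → 1 ≤ k → 2 ^ (100 * k) ≤ n → BuilderWinsBipartite n k)
theorem1 n large = painter , (λ k 1≤k le → builder-beats-painter (initial-sparse {n} {k}) (builder-wins n k 1≤k le)) , builder-wins n
  where
  4≤n : 4 ≤ n
  4≤n = ≤-trans (≤ᵇ⇒≤ 4 (10 ^ 8) tt) (<⇒≤ large)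
  painter : Σ ℕ λ k → 1 ≤ k × 2 ^ (k ∸ 1) ≤ n × PainterWins n k
  painter with j , lo , hi ← binary-length n (≤-trans (s≤s z≤n) 4≤n) =
    -- At least three colours, because 4 ≤ `n` < `2 ^ suc j`.
    suc j , s≤s z≤n , lo , painter-wins (≤-trans (s≤s z≤n) 4≤n)
      (≰⇒> (λ le → <-irrefl refl (≤-trans hi (≤-trans (^-monoʳ-≤ 2 le) 4≤n)))) hi
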